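{- There is a PRAX algorithm for block NFA universality that works in time $O\big(\ell\,|\bm{a}|\,(1/\varepsilon)\big)$, where $\bm{a}$ is the given block NFA, $\ell$ is its word length, and $\varepsilon\in(0,1)$ is the given tolerance.
   Context: A block NFA is a nondeterministic finite automaton $\bm{a}$ over some alphabet $\Sigma$ accepting only words of one fixed length $\ell$ (its word length, which can be computed from $\bm{a}$ in time $O(|\bm{a}|)$); $\mathcal{L}(\bm{a})\subseteq\Sigma^\ell$ is the language it accepts. The size $|\bm{a}|$ is the number of states plus the number of transitions. Let $\mathsf{B}(\bm{a})$ denote the probability of $\mathcal{L}(\bm{a})$ under the uniform distribution on $\Sigma^\ell$, i.e. $\mathsf{B}(\bm{a})=|\mathcal{L}(\bm{a})|/|\Sigma|^\ell$. Block NFA universality is the problem $U_{\mathsf{B}}=\{\bm{a}:\mathsf{B}(\bm{a})=1\}$ (i.e. whether $\mathcal{L}(\bm{a})=\Sigma^\ell$), and for $\varepsilon\in(0,1)$, $U_{\mathsf{B},\varepsilon}=\{\bm{a}:\mathsf{B}(\bm{a})\ge 1-\varepsilon\}$. A PRAX algorithm for $U_{\mathsf{B}}$ is a randomized algorithm $A(\bm{a},\varepsilon)$ that halts on every input with answer $\mathsf{True}$ or $\mathsf{False}$ such that: (1) if $\bm{a}\in U_{\mathsf{B}}$ then $A(\bm{a},\varepsilon)=\mathsf{True}$; (2) if $\bm{a}\notin U_{\mathsf{B},\varepsilon}$ then $\mathrm{P}[A(\bm{a},\varepsilon)=\mathsf{False}]\ge 3/4$; (3) $A(\bm{a},\varepsilon)$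 works in time polynomial in $1/\varepsilon$ and the size of $\bm{a}$. Computational model: unit cost for arithmetic operations, for tossing a biased coin, and for uniformly selecting one alphabet symbol.
   Formalization: The given tolerance ε is a rational number in (0,1), supplied to the algorithm as numerator and denominator, instead of an arbitrary real in (0,1). -}

module Defs where

open import Data.Bool.Base using (Bool; true; false; not; if_then_else_; _∧_)
open import Data.Fin.Base using (Fin; toℕ)
open import Data.Fin.Properties using (any?) renaming (_≟_ to _≟ᶠ_)
open import Data.Fin.Subset using (Subset; _∈_)
open import Data.Fin.Subset.Properties using (_∈?_)
open import Data.Integer.Base using (+_; ∣_∣)
open import Data.List.Base using (List; []; _∷_; _++_; map; filter; length; foldr; allFin; cartesianProductWith)
import Data.List.Membership.Propositional as List
import Data.List.Membership.DecPropositional as ListDec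
open import Data.List.Relation.Unary.Unique.Propositional using (Unique)
open import Data.Nat.Base using (ℕ; zero; suc; _+_; _*_; _∸_; _^_; _⊓_; _⊔_; _≡ᵇ_; _<ᵇ_; NonZero)
import Data.Nat.DivMod as ℕ
open import Data.Nat.Properties using (m^n≢0)
open import Data.Product.Base using (_×_; _,_; proj₁; proj₂; ∃)
open import Data.Product.Properties using (≡-dec)
open import Data.Rational.Base as ℚ using (ℚ; 0ℚ; 1ℚ; 1/_; _/_; positive; ↥_; ↧ₙ_)
open import Data.Rational.Properties using (pos⇒nonZero)
open import Data.Vec.Base using (Vec; toList)
import Data.Vec.Functional as Vector
open import Relation.Binary.PropositionalEquality using (_≡_)
open import Relation.Nullary using (¬_; Dec; _×-dec_)

------------------------------------------------------------------------
-- Block NFAs over the alphabet Fin s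

Word : ℕ → Set
Word s = List (Fin s)

record NFA (s : ℕ) : Set where
  field
    states      : ℕ
    initial     : Subset states
    final       : Subset states
    transitions : List (Fin states × Fin s × Fin states)
    distinct    : Unique transitions

  AcceptsFrom : Fin states → Word s → Set
  AcceptsFrom q []      = q ∈ final
  AcceptsFrom q (σ ∷ w) = ∃ λ q′ → (q , σ , q′) List.∈ transitions × AcceptsFrom q′ w

  Accepts : Word s → Set
  Accepts w = ∃ λ q → q ∈ initial × AcceptsFrom q w

  acceptsFrom? : ∀ q w → Dec (AcceptsFrom q w)
  acceptsFrom? q []      = q ∈? final
  acceptsFrom? q (σ ∷ w) =
    any? λ q′ → ((q , σ , q′) ∈ₜ? transitions) ×-dec acceptsFrom? q′ w
    where open ListDec (≡-dec _≟ᶠ_ (≡-dec _≟ᶠ_ _≟ᶠ_)) renaming (_∈?_ to _∈ₜ?_)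

  accepts? : ∀ w → Dec (Accepts w)
  accepts? w = any? λ q → (q ∈? initial) ×-dec acceptsFrom? q w

  size : ℕ
  size = states + length transitions

-- If the language is empty, every ℓ is admissible as the word length.
record BlockNFA (s : ℕ) : Set where
  field
    nfa        : NFA s
    ℓ          : ℕ
    wordLength : ∀ w → NFA.Accepts nfa w → length w ≡ ℓ

  open NFA nfa public

words : (s ℓ : ℕ) → List (Word s)
words s zero    = [] ∷ []
words s (suc ℓ) = cartesianProductWith _∷_ (allFin s) (words s ℓ)

module _ {s : ℕ} .{{_ : NonZero s}} (a : BlockNFA s) where
  open BlockNFA a

  B : ℚ
  B = _/_ (+ length (filter accepts? (words s ℓ))) (s ^ ℓ) {{m^n≢0 s ℓ}}

  Universal : Set
  Universal = B ≡ 1ℚ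

  UniversalUpTo : ℚ → Set
  UniversalUpTo ε = (1ℚ ℚ.- ε) ℚ.≤ B

record Tolerance : Set where
  field
    value : ℚ
    0<ε   : 0ℚ ℚ.< value
    ε<1   : value ℚ.< 1ℚ

  inverse : ℚ
  inverse = (1/ value) {{pos⇒nonZero value {{positive 0<ε}}}}

------------------------------------------------------------------------
-- Randomized random-access programs.  The memory consists of
-- named arrays of natural numbers; a scalar variable is an array that is
-- only used at index 0.

State : Set
State = ℕ → ℕ → ℕ

_[_,_]≔_ : State → ℕ → ℕ → ℕ → State
(σ [ x , i ]≔ v) y j = if (y ≡ᵇ x) ∧ (j ≡ᵇ i) then v else σ y j

data Op : Set where
  add sub mul div mod eq lt : Op

-- Subtraction is truncated; division and remainder by 0 give 0.
⟦_⟧ᵒ : Op → ℕ → ℕ → ℕ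
⟦ add ⟧ᵒ m n       = m + n
⟦ sub ⟧ᵒ m n       = m ∸ n
⟦ mul ⟧ᵒ m n       = m * n
⟦ div ⟧ᵒ m zero    = 0
⟦ div ⟧ᵒ m (suc n) = m ℕ./ suc n
⟦ mod ⟧ᵒ m zero    = 0
⟦ mod ⟧ᵒ m (suc n) = m ℕ.% suc n
⟦ eq  ⟧ᵒ m n       = if m ≡ᵇ n then 1 else 0
⟦ lt  ⟧ᵒ m n       = if m <ᵇ n then 1 else 0

data Expr : Set where
  lit  : ℕ → Expr
  read : (array : ℕ) (index : Expr) → Expr
  op   : Op → Expr → Expr → Expr

⟦_⟧ : Expr → State → ℕ
⟦ lit n ⟧      σ = n
⟦ read x i ⟧   σ = σ x (⟦ i ⟧ σ)
⟦ op o e₁ e₂ ⟧ σ = ⟦ o ⟧ᵒ (⟦ e₁ ⟧ σ) (⟦ e₂ ⟧ σ)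

-- Every constant, memory access and arithmetic operation has unit cost.
cost : Expr → ℕ
cost (lit n)      = 1
cost (read x i)   = 1 + cost i
cost (op o e₁ e₂) = 1 + cost e₁ + cost e₂

-- In the first three statements the array cell (x , i) is the target.
data Stmt : Set where
  assign : (x : ℕ) (i e : Expr) → Stmt
  symbol : (x : ℕ) (i : Expr) → Stmt
  toss   : (x : ℕ) (i num den : Expr) → Stmt
  branch : (e : Expr) (then else : List Stmt) → Stmt
  while  : (e : Expr) (body : List Stmt) → Stmt

Block : Set
Block = List Stmt

-- The probability of 1 ("heads") for a coin with bias m / n; it is capped
-- at 1, also when n = 0.
bias : ℕ → ℕ → ℚ
bias m zero    = 1ℚ
bias m (suc n) = + (m ⊓ suc n) / suc n

nonzero : ℕ → Bool
nonzero n = not (n ≡ᵇ 0)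

-- Run s b σ is the tree of all possible executions of b from σ, branching
-- over the random outcomes, with symbols selected from Fin s.  Being
-- inductive, it is inhabited only if every execution terminates; it has at
-- most one inhabitant up to pointwise equality of subtrees.
data Run (s : ℕ) : Block → State → Set where
  halt   : ∀ {σ} → Run s [] σ
  assign : ∀ {x i e b σ} →
           Run s b (σ [ x , ⟦ i ⟧ σ ]≔ ⟦ e ⟧ σ) →
           Run s (assign x i e ∷ b) σ
  symbol : ∀ {x i b σ} →
           ((c : Fin s) → Run s b (σ [ x , ⟦ i ⟧ σ ]≔ toℕ c)) →
           Run s (symbol x i ∷ b) σ
  toss   : ∀ {x i num den b σ} →
           (heads : Run s b (σ [ x , ⟦ i ⟧ σ ]≔ 1)) →
           (tails : Run s b (σ [ x , ⟦ i ⟧ σ ]≔ 0)) →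
           Run s (toss x i num den ∷ b) σ
  branch : ∀ {e b₁ b₂ b σ} →
           Run s ((if nonzero (⟦ e ⟧ σ) then b₁ else b₂) ++ b) σ →
           Run s (branch e b₁ b₂ ∷ b) σ
  while  : ∀ {e body b σ} →
           Run s (if nonzero (⟦ e ⟧ σ) then body ++ while e body ∷ b else b) σ →
           Run s (while e body ∷ b) σ

-- Worst case over the random outcomes.
time : ∀ {s b σ} → Run s b σ → ℕ
time halt                   = 0
time (assign {i = i} {e} r) = 1 + cost i + cost e + time r
time (symbol {i = i} r)     = 1 + cost i + Vector.foldr _⊔_ 0 (λ c → time (r c))
time (toss {i = i} {num} {den} h t) =
  1 + cost i + cost num + cost den + (time h ⊔ time t)
time (branch {e} r)         = 1 + cost e + time r
time (while {e} r)          = 1 + cost e + time r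

Pr : ∀ {s b σ} .{{_ : NonZero s}} → (State → Bool) → Run s b σ → ℚ
Pr P (halt {σ})     = if P σ then 1ℚ else 0ℚ
Pr P (assign r)     = Pr P r
Pr {s} P (symbol r) = (+ 1 / s) ℚ.* Vector.foldr ℚ._+_ 0ℚ (λ c → Pr P (r c))
Pr P (toss {num = num} {den} {σ = σ} h t) =
  p ℚ.* Pr P h ℚ.+ (1ℚ ℚ.- p) ℚ.* Pr P t
  where p = bias (⟦ num ⟧ σ) (⟦ den ⟧ σ)
Pr P (branch r)     = Pr P r
Pr P (while r)      = Pr P r

------------------------------------------------------------------------
-- Input and output

contents : List ℕ → ℕ → ℕ
contents []       _       = 0
contents (v ∷ vs) zero    = v
contents (v ∷ vs) (suc i) = contents vs i

flags : ∀ {n} → Subset n → List ℕ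
flags p = map (λ b → if b then 1 else 0) (toList p)

-- Transition number i is (source , symbol , target) at index i of the
-- arrays 3, 4 and 5.  The word length is not part of the input.
encode : ∀ {s} → NFA s → Tolerance → State
encode {s} a ε = memory
  where
  open NFA a
  open Tolerance ε
  memory : State
  memory 0 = contents (states ∷ length transitions ∷ s ∷ ∣ ↥ value ∣ ∷ ↧ₙ value ∷ [])
  memory 1 = contents (flags initial)
  memory 2 = contents (flags final)
  memory 3 = contents (map (λ t → toℕ (proj₁ t)) transitions)
  memory 4 = contents (map (λ t → toℕ (proj₁ (proj₂ t))) transitions)
  memory 5 = contents (map (λ t → toℕ (proj₂ (proj₂ t))) transitions)
  memory _ = λ _ → 0

-- The answer is left in cell 0 of array 0: nonzero for True, 0 for False.
True False : State → Bool
True  σ = nonzero (σ 0 0)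
False σ = not (True σ)

------------------------------------------------------------------------
-- PRAX algorithms for block NFA universality

fromℕ : ℕ → ℚ
fromℕ n = + n / 1

-- Coefficients are listed by increasing degree.
evalPoly : List ℚ → ℚ → ℚ
evalPoly cs x = foldr (λ c v → c ℚ.+ x ℚ.* v) 0ℚ cs

evalPoly₂ : List (List ℚ) → ℚ → ℚ → ℚ
evalPoly₂ css x y = evalPoly (map (λ cs → evalPoly cs x) css) y

record IsPRAX (A : Block) : Set where
  open BlockNFA using (nfa; size)
  open Tolerance using (value; inverse)
  field
    run        : ∀ {s} .{{_ : NonZero s}} (a : BlockNFA s) (ε : Tolerance) →
                 Run s A (encode (nfa a) ε)
    universal  : ∀ {s} .{{_ : NonZero s}} (a : BlockNFA s) (ε : Tolerance) →
                 Universal a → Pr True (run a ε) ≡ 1ℚ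
    far        : ∀ {s} .{{_ : NonZero s}} (a : BlockNFA s) (ε : Tolerance) →
                 ¬ UniversalUpTo a (value ε) → + 3 / 4 ℚ.≤ Pr False (run a ε)
    polynomial : ∃ λ (p : List (List ℚ)) →
                 ∀ {s} .{{_ : NonZero s}} (a : BlockNFA s) (ε : Tolerance) →
                 fromℕ (time (run a ε)) ℚ.≤ evalPoly₂ p (fromℕ (size a)) (inverse ε)

-- Time O(ℓ |a| (1/ε)), with one constant for all inputs (and all alphabets).
-- Factors that vanish in degenerate cases (ℓ = 0, no states) are read as 1,
-- since the running time is positive even then.
TimeO[ℓ·size·1/ε] : {A : Block} → IsPRAX A → Set
TimeO[ℓ·size·1/ε] P =
  ∃ λ (C : ℕ) → ∀ {s} .{{_ : NonZero s}} (a : BlockNFA s) (ε : Tolerance) →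
  fromℕ (time (run a ε))
    ℚ.≤ fromℕ (C * ((1 ⊔ ℓ a) * (1 ⊔ size a))) ℚ.* inverse ε
  where
  open IsPRAX P
  open BlockNFA using (ℓ; size)
  open Tolerance using (inverse)

{-# OPTIONS --safe #-}
module Submission where

-- The algorithm computes a candidate L for the word length and answers True
-- if and only if the automaton accepts each of n = floor (3 / ε) + 1
-- independent uniform words of length L.
--
-- Word length.  As all accepted words have length ℓ, every path from an
-- initial to a final state has ℓ edges, so any graph search that records the
-- lengths of its paths finds ℓ.  The program uses depth-first search on
-- linked adjacency lists.  Each round uses up one transition or pops one
-- state, so the number of unvisited states plus unused transitions plus
-- stacked states drops by one (consume, pop; visiting a state leaves it
-- unchanged), and the search takes time linear in |a|.  When the stack is
-- empty, the visited states are closed under transitions; if no final state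
-- was found, the language is empty (outcome).  Then L = 0, and every trial
-- rejects.  A linear bound that does not involve ℓ is needed in this case,
-- because ℓ is arbitrary when the language is empty.
--
-- Trials.  A random word is drawn from its last letter to its first.  The
-- set of states from which c ∷ w is accepted arises from the set for w by one
-- scan of the transitions (scanned-represents), so a trial takes time
-- O((1 + L) (1 + |a|)).  Averaging over words that grow at the front agrees
-- with averaging over all words (average≡mean), so a trial succeeds with
-- probability B a (mean-length), and the answer is True with probability
-- exactly (B a) ^ n (executes).
--
-- Error and time.  This is 1 if B a = 1.  If B a < 1 - ε, then
-- (B a) ^ n (1 + n ε) ≤ 1 (bernoulli) and n ε ≥ 3 give (B a) ^ n ≤ 1/4.
-- Finally n ≤ 4 / ε and L ≤ ℓ give time O(ℓ |a| (1/ε)), and L ≤ |a| gives a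
-- polynomial bound in |a| and 1/ε (time≤).

open import Defs
open import Algebra.Bundles using (module CommutativeRing)
open import Data.Bool.Base using (Bool; true; false; if_then_else_)
open import Data.Empty using (⊥; ⊥-elim)
open import Data.Fin.Base using (Fin; zero; suc; toℕ; fromℕ<)
open import Data.Fin.Properties using (toℕ<n; toℕ-injective; toℕ-fromℕ<)
import Data.Fin.Subset as Subset
open import Data.Integer.Base as ℤ using (+_; ∣_∣; +≤+)
import Data.Integer.Properties as ℤ
open import Data.List.Base
  using (List; []; _∷_; _++_; length; map; filter; lookup; tabulate; cartesianProductWith)
open import Data.List.Membership.Propositional using (_∈_)
open import Data.List.Membership.Propositional.Properties using (∈-lookup)
open import Data.List.Properties using (filter-++; length-++; ++-assoc; ++-identityʳ)
open import Data.List.Relation.Unary.Any using (here; there; index)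
open import Data.List.Relation.Unary.Any.Properties using (lookup-index)
open import Data.Nat.Base
import Data.Nat.DivMod as ℕ
open import Data.Nat.Properties
import Data.Nat.Tactic.RingSolver as ℕ-Ring
open import Data.Product.Base using (Σ; ∃; _×_; _,_; proj₁; proj₂)
open import Data.Rational.Base as ℚ using (ℚ; 0ℚ; 1ℚ; mkℚ; toℚᵘ; ↥_; ↧ₙ_; *<*)
import Data.Rational.Properties as ℚ
open import Data.Rational.Solver using (module +-*-Solver)
open import Data.Rational.Unnormalised.Base as ℚᵘ using (mkℚᵘ; *≡*; *≤*)
import Data.Rational.Unnormalised.Properties as ℚᵘ
open import Data.Sum.Base using (_⊎_; inj₁; inj₂)
open import Data.Vec.Base using (_∷_; here; there)
import Data.Vec.Functional as Vector
open import Function.Base using (_∘_)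
open import Relation.Binary.PropositionalEquality
open import Relation.Nullary using (¬_; yes; no; Dec; does)
import Relation.Nullary.Decidable as Dec
open import Relation.Unary using (Decidable)
open import Algebra.Definitions.RawSemiring ℚ.+-*-rawSemiring using () renaming (_^_ to _^ℚ_)
open import Algebra.Properties.Semiring.Sum (CommutativeRing.semiring ℚ.+-*-commutativeRing)
  using (sum; sum-cong-≗; *-distribˡ-sum; ∑-comm; ∑-distrib-+)
open +-*-Solver using (solve; con; _:+_; _:*_; _:-_; _:=_)

-- Reasoning about executions

⊔-lub-Fin : ∀ {n T} (f : Fin n → ℕ) → (∀ c → f c ≤ T) → Vector.foldr _⊔_ 0 f ≤ T
⊔-lub-Fin {zero}  f f≤T = z≤n
⊔-lub-Fin {suc n} f f≤T = ⊔-lub (f≤T zero) (⊔-lub-Fin (λ c → f (suc c)) λ c → f≤T (suc c))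

module Logic (s : ℕ) .{{_ : NonZero s}} where

  -- A terminating execution tree of b from σ that takes time at most T and
  -- answers True with probability exactly p.  The rules below build such trees
  -- from the end of the program, statement by statement.
  record Execution (b : Block) (σ : State) (T : ℕ) (p : ℚ) : Set where
    constructor execution
    field
      run   : Run s b σ
      time≤ : time run ≤ T
      Pr≡   : Pr True run ≡ p

  weaken : ∀ {b σ T T′ p} → T ≤ T′ → Execution b σ T p → Execution b σ T′ p
  weaken T≤T′ (execution r t q) = execution r (≤-trans t T≤T′) q

  halts : ∀ {σ} → Execution [] σ 0 (if True σ then 1ℚ else 0ℚ)
  halts = execution halt z≤n refl

  -- The values j and v of the index and the expression are passed separately,
  -- so that the next state is stated in terms of the values intended by the
  -- invariants.
  assigns : ∀ {x i e b σ T p} j v → ⟦ i ⟧ σ ≡ j → ⟦ e ⟧ σ ≡ v →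
            Execution b (σ [ x , j ]≔ v) T p →
            Execution (assign x i e ∷ b) σ (1 + cost i + cost e + T) p
  assigns {i = i} {e} _ _ refl refl (execution r t q) =
    execution (assign r) (+-monoʳ-≤ (1 + cost i + cost e) t) q

  selects : ∀ {x i b σ T} {p : Fin s → ℚ} j → ⟦ i ⟧ σ ≡ j →
            (∀ c → Execution b (σ [ x , j ]≔ toℕ c) T (p c)) →
            Execution (symbol x i ∷ b) σ (1 + cost i + T) ((+ 1 ℚ./ s) ℚ.* sum p)
  selects {i = i} _ refl f = execution (symbol λ c → Execution.run (f c))
    (+-monoʳ-≤ (1 + cost i) (⊔-lub-Fin _ λ c → Execution.time≤ (f c)))
    (cong ((+ 1 ℚ./ s) ℚ.*_) (sum-cong-≗ λ c → Execution.Pr≡ (f c)))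

  branches-then : ∀ {e b₁ b₂ b σ T p} → ⟦ e ⟧ σ ≢ 0 →
                  Execution (b₁ ++ b) σ T p → Execution (branch e b₁ b₂ ∷ b) σ (1 + cost e + T) p
  branches-then {e} {b₁} {b₂} {b} {σ} {T} {p} ne x = go (⟦ e ⟧ σ) refl
    where
    go : ∀ v → ⟦ e ⟧ σ ≡ v → Execution (branch e b₁ b₂ ∷ b) σ (1 + cost e + T) p
    go zero ev = ⊥-elim (ne ev)
    go (suc v) ev
      with execution r t q ←
        subst (λ v → Execution ((if nonzero v then b₁ else b₂) ++ b) σ T p) (sym ev) x
      = execution (branch r) (+-monoʳ-≤ (1 + cost e) t) q

  branches-else : ∀ {e b₁ b₂ b σ T p} → ⟦ e ⟧ σ ≡ 0 →
                  Execution (b₂ ++ b) σ T p → Execution (branch e b₁ b₂ ∷ b) σ (1 + cost e + T) p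
  branches-else {e} {b₁} {b₂} {b} {σ} {T} {p} ev x
    with execution r t q ←
      subst (λ v → Execution ((if nonzero v then b₁ else b₂) ++ b) σ T p) (sym ev) x
    = execution (branch r) (+-monoʳ-≤ (1 + cost e) t) q

  while-exits : ∀ {e body b σ T p} → ⟦ e ⟧ σ ≡ 0 →
                Execution b σ T p → Execution (while e body ∷ b) σ (1 + cost e + T) p
  while-exits {e} {body} {b} {σ} {T} {p} ev x
    with execution r t q ←
      subst (λ v → Execution (if nonzero v then body ++ while e body ∷ b else b) σ T p) (sym ev) x
    = execution (while r) (+-monoʳ-≤ (1 + cost e) t) q

  while-enters : ∀ {e body b σ T p v} → ⟦ e ⟧ σ ≡ suc v →
                 Execution (body ++ while e body ∷ b) σ T p →
                 Execution (while e body ∷ b) σ (1 + cost e + T) p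
  while-enters {e} {body} {b} {σ} {T} {p} ev x
    with execution r t q ←
      subst (λ v → Execution (if nonzero v then body ++ while e body ∷ b else b) σ T p) (sym ev) x
    = execution (while r) (+-monoʳ-≤ (1 + cost e) t) q

  -- A specification in continuation-passing style.  From σ, the block b takes
  -- time at most c, and each of its executions ends in a state σ′ with Post σ′ p′
  -- for some p′.  If the rest k of the program then answers True with probability
  -- p′ in every such case, b and k together do so with probability p.
  Spec : Block → State → ℕ → ℚ → (State → ℚ → Set) → Set
  Spec b σ c p Post = ∀ {k T} → (∀ σ′ p′ → Post σ′ p′ → Execution k σ′ T p′) →
                      Execution (b ++ k) σ (c + T) p

  -- The special case in which running b does not change the probability of
  -- True, as for all blocks without random choices.
  Det : Block → State → ℕ → (State → Set) → Set
  Det b σ c Post = ∀ {k T p} → (∀ σ′ → Post σ′ → Execution k σ′ T p) →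
                   Execution (b ++ k) σ (c + T) p

  -- The first argument of the invariant bounds the number of remaining rounds:
  -- each round decreases it by exactly one.
  while-spec : ∀ {e body c} (Inv : ℕ → State → ℚ → Set) →
    (∀ n σ p → Inv n σ p → ⟦ e ⟧ σ ≢ 0 → ∃ λ n′ → n ≡ suc n′ × Spec body σ c p (Inv n′)) →
    ∀ n σ p → Inv n σ p →
    Spec (while e body ∷ []) σ (n * (1 + cost e + c) + (1 + cost e)) p
         (λ σ′ p′ → ∃ λ n′ → Inv n′ σ′ p′ × ⟦ e ⟧ σ′ ≡ 0)
  while-spec {e} {body} {c} Inv step n σ p inv {k} {T} post = go n σ p inv (⟦ e ⟧ σ) refl
    where
    w = 1 + cost e
    go : ∀ n σ p → Inv n σ p → ∀ v → ⟦ e ⟧ σ ≡ v →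
         Execution (while e body ∷ k) σ (n * (w + c) + w + T) p
    go n σ p inv zero ev =
      weaken (+-monoˡ-≤ T (m≤n+m w (n * (w + c)))) (while-exits ev (post σ p (n , inv , ev)))
    go n σ p inv (suc v) ev with step n σ p inv (λ ev′ → 0≢1+n (trans (sym ev′) ev))
    ... | n′ , refl , spec =
      weaken (≤-reflexive (time-eq w c (n′ * (w + c)) T))
             (while-enters ev (spec λ σ′ p′ inv′ → go n′ σ′ p′ inv′ _ refl))
      where
      time-eq : ∀ w c y T → w + (c + (y + w + T)) ≡ w + c + y + w + T
      time-eq = ℕ-Ring.solve-∀

-- Scalar variables are arrays that are only used at index 0.
var : ℕ → Expr
var x = read x (lit 0)

set : ℕ → Expr → Stmt
set x e = assign x (lit 0) e

-- The loop over x - 1, x - 2, ..., 0, for the current value of x; the body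
-- must preserve x.
for : ℕ → Block → Stmt
for x body = while (var x) (set x (op sub (var x) (lit 1)) ∷ body)

module Loops (s : ℕ) .{{_ : NonZero s}} where
  open Logic s

  for-spec : ∀ {x body c} (Inv : ℕ → State → ℚ → Set) →
    (∀ n σ p → Inv (suc n) σ p → σ x 0 ≡ suc n →
      Spec body (σ [ x , 0 ]≔ n) c p (λ σ′ p′ → Inv n σ′ p′ × σ′ x 0 ≡ n)) →
    ∀ n σ p → Inv n σ p → σ x 0 ≡ n →
    Spec (for x body ∷ []) σ (n * (9 + c) + 3) p (Inv 0)
  for-spec {x} {body} {c} Inv step n σ p inv ev post =
    while-spec Inv′ step′ n σ p (inv , ev) λ σ′ p′ → exit σ′ p′
    where
    Inv′ : ℕ → State → ℚ → Set
    Inv′ n σ p = Inv n σ p × σ x 0 ≡ n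
    step′ : ∀ n σ p → Inv′ n σ p → σ x 0 ≢ 0 →
      ∃ λ n′ → n ≡ suc n′ × Spec (set x (op sub (var x) (lit 1)) ∷ body) σ (6 + c) p (Inv′ n′)
    step′ zero    σ p (inv , ev) ne = ⊥-elim (ne ev)
    step′ (suc n) σ p (inv , ev) ne =
      n , refl , λ k → assigns 0 n refl (cong (_∸ 1) ev) (step n σ p inv ev k)
    exit : ∀ σ′ p′ → (∃ λ n′ → Inv′ n′ σ′ p′ × σ′ x 0 ≡ 0) → _
    exit σ′ p′ (n′ , (inv′ , ev′) , ev₀) =
      post σ′ p′ (subst (λ n → Inv n σ′ p′) (trans (sym ev′) ev₀) inv′)

  for-det : ∀ {x body c} (Inv : ℕ → State → Set) →
    (∀ n σ → Inv (suc n) σ → σ x 0 ≡ suc n →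
      Det body (σ [ x , 0 ]≔ n) c (λ σ′ → Inv n σ′ × σ′ x 0 ≡ n)) →
    ∀ n σ → Inv n σ → σ x 0 ≡ n →
    Det (for x body ∷ []) σ (n * (9 + c) + 3) (Inv 0)
  for-det Inv step n σ inv ev {p = p} post =
    for-spec (λ n σ p′ → Inv n σ × p′ ≡ p)
      (λ { n σ p (inv , refl) ev post →
           step n σ inv ev λ σ′ (inv′ , ev′) → post σ′ p ((inv′ , refl) , ev′) })
      n σ p (inv , refl) ev
      λ { σ′ p (inv′ , refl) → post σ′ inv′ }

  while-det : ∀ {e body c} (Inv : ℕ → State → Set) →
    (∀ n σ → Inv n σ → ⟦ e ⟧ σ ≢ 0 → ∃ λ n′ → n ≡ suc n′ × Det body σ c (Inv n′)) →
    ∀ n σ → Inv n σ →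
    Det (while e body ∷ []) σ (n * (1 + cost e + c) + (1 + cost e))
         (λ σ′ → ∃ λ n′ → Inv n′ σ′ × ⟦ e ⟧ σ′ ≡ 0)
  while-det Inv step n σ inv {p = p} post =
    while-spec (λ n σ p′ → Inv n σ × p′ ≡ p)
      (λ { n σ p (inv , refl) ne →
           let n′ , ev , spec = step n σ inv ne in
           n′ , ev , λ post → spec λ σ′ inv′ → post σ′ p (inv′ , refl) })
      n σ p (inv , refl)
      λ { σ′ p (n′ , (inv′ , refl) , ev) → post σ′ (n′ , inv′ , ev) }

-- Arrays, linked lists and stacks in memory

-- The effect of an assignment on the array that it changes.  For distinct
-- literal array names x and y, (σ [ x , i ]≔ v) x is upd (σ x) i v and
-- (σ [ x , i ]≔ v) y is σ y, both by computation.  Predicates that refer to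
-- the state only through such arrays therefore need no frame lemmas.
upd : ∀ {A : Set} → (ℕ → A) → ℕ → A → ℕ → A
upd f i v j = if j ≡ᵇ i then v else f j

upd-same : ∀ {A : Set} (f : ℕ → A) i v → upd f i v i ≡ v
upd-same f i v with i ≡ᵇ i | ≡⇒≡ᵇ i i refl
... | true | _ = refl

upd-other : ∀ {A : Set} (f : ℕ → A) i v {j} → j ≢ i → upd f i v j ≡ f j
upd-other f i v {j} j≢i with j ≡ᵇ i | ≡ᵇ⇒≡ j i
... | true  | j≡i = ⊥-elim (j≢i (j≡i _))
... | false | _   = refl

upd-elim : ∀ {A : Set} (P : ℕ → A → Set) (f : ℕ → A) i v →
           P i v → (∀ j → j ≢ i → P j (f j)) → ∀ j → P j (upd f i v j)
upd-elim P f i v Pv Pf j with j ≟ i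
... | yes refl = subst (P i) (sym (upd-same f i v)) Pv
... | no j≢i   = subst (P j) (sym (upd-other f i v j≢i)) (Pf j j≢i)

-- The sum of f over the indices below n.
sumTo : ℕ → (ℕ → ℕ) → ℕ
sumTo zero    f = 0
sumTo (suc n) f = f n + sumTo n f

sumTo-cong : ∀ n {f g} → (∀ i → i < n → f i ≡ g i) → sumTo n f ≡ sumTo n g
sumTo-cong zero    f≗g = refl
sumTo-cong (suc n) f≗g =
  cong₂ _+_ (f≗g n (n<1+n n)) (sumTo-cong n λ i i<n → f≗g i (m<n⇒m<1+n i<n))

sumTo-1 : ∀ n → sumTo n (λ _ → 1) ≡ n
sumTo-1 zero    = refl
sumTo-1 (suc n) = cong suc (sumTo-1 n)

sumTo-suc : ∀ n {f g} q → q < n → f q ≡ suc (g q) → (∀ i → i ≢ q → f i ≡ g i) →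
            sumTo n f ≡ suc (sumTo n g)
sumTo-suc (suc n) {f} {g} q q<1+n fq f≗g with n ≟ q
... | yes refl = cong₂ _+_ fq (sumTo-cong n λ i i<n → f≗g i (<⇒≢ i<n))
... | no n≢q   = trans
  (cong₂ _+_ (f≗g n n≢q)
    (sumTo-suc n q (≤∧≢⇒< (≤-pred q<1+n) (n≢q ∘ sym)) fq f≗g))
  (+-suc (g n) _)

-- The linked list with the given head pointer has the given elements.
-- A pointer is 0 for the empty list, and suc t for a list that starts at t.
data Chain (next : ℕ → ℕ) : ℕ → List ℕ → Set where
  end  : Chain next 0 []
  link : ∀ {t ts} → Chain next (next t) ts → Chain next (suc t) (t ∷ ts)

Chain-upd : ∀ {next h ts} i v → (∀ {t} → t ∈ ts → t ≢ i) →
            Chain next h ts → Chain (upd next i v) h ts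
Chain-upd i v fresh end = end
Chain-upd {next} i v fresh (link {t} ch) =
  link (subst (λ h → Chain (upd next i v) h _)
              (sym (upd-other next i v (fresh (here refl))))
              (Chain-upd i v (fresh ∘ there) ch))

-- The cells below the stack pointer contain the given list, whose first
-- element is the top of the stack.
data Stack (cell : ℕ → ℕ) : ℕ → List ℕ → Set where
  empty : Stack cell 0 []
  push  : ∀ {k q qs} → cell k ≡ q → Stack cell k qs → Stack cell (suc k) (q ∷ qs)

Stack-upd : ∀ {cell k qs} i v → k ≤ i → Stack cell k qs → Stack (upd cell i v) k qs
Stack-upd i v k≤i empty = empty
Stack-upd {cell} i v k<i (push ev st) =
  push (trans (upd-other cell i v (<⇒≢ k<i)) ev) (Stack-upd i v (<⇒≤ k<i) st)

-- Transition graphs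

-- An automaton as the program sees it: N states and m transitions, both given
-- by their numbers, and arrays for the initial and final flags and for the
-- sources, labels and targets of the transitions.
record Graph (s : ℕ) : Set where
  field
    N m : ℕ
    init fin src lab tgt : ℕ → ℕ
    src< : ∀ {t} → t < m → src t < N
    tgt< : ∀ {t} → t < m → tgt t < N
    lab∈ : ∀ {t} → t < m → ∃ λ (c : Fin s) → lab t ≡ toℕ c

  -- Acceptance from a state.
  Acc : Word s → ℕ → Set
  Acc []      q = fin q ≢ 0
  Acc (c ∷ w) q = ∃ λ t → t < m × src t ≡ q × lab t ≡ toℕ c × Acc w (tgt t)

  Accepted : Word s → Set
  Accepted w = ∃ λ q → q < N × init q ≢ 0 × Acc w q

  -- What the search needs of a path of d edges from an initial state to q: for
  -- each word v accepted from q, it gives an accepted word of d more letters.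
  Hits : ℕ → ℕ → Set
  Hits d q = ∀ v → Acc v q → ∃ λ u → Accepted u × length u ≡ d + length v

  Hits-initial : ∀ {q} → q < N → init q ≢ 0 → Hits 0 q
  Hits-initial q<N iq v av = v , (_ , q<N , iq , av) , refl

  Hits-edge : ∀ {d t} → t < m → Hits d (src t) → Hits (suc d) (tgt t)
  Hits-edge {d} {t} t<m hits v av =
    let c , lab≡ = lab∈ t<m
        u , acc , len = hits (c ∷ v) (t , t<m , refl , lab≡ , av)
    in u , acc , trans len (+-suc d (length v))

  -- The input arrays 0 to 5 contain the graph and the tolerance ε₁ / ε₂.  The
  -- arrays are separate parameters, so that assignments to other arrays
  -- preserve this property by computation.
  record Inputs (ε₁ ε₂ : ℕ) (f₀ f₁ f₂ f₃ f₄ f₅ : ℕ → ℕ) : Set where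
    field
      N≡    : f₀ 0 ≡ N
      m≡    : f₀ 1 ≡ m
      num≡  : f₀ 3 ≡ ε₁
      den≡  : f₀ 4 ≡ ε₂
      init≡ : ∀ q → f₁ q ≡ init q
      fin≡  : ∀ q → f₂ q ≡ fin q
      src≡  : ∀ t → f₃ t ≡ src t
      lab≡  : ∀ t → f₄ t ≡ lab t
      tgt≡  : ∀ t → f₅ t ≡ tgt t

-- The program

-- Names of arrays.  For a state q, depth# is 0 if q is unvisited, and
-- otherwise one more than the length of the path on which q was reached; head#
-- points to the unused transitions from q.  In the same way, found# is one more
-- than the length of an accepted word, or 0 if none was found.  The arrays
-- row# and newRow# are characteristic functions of sets of states.
initial# final# source# label# target# counter# head# next# depth# stack# top# found# : ℕ
state# edge# child# trial# letters# row# newRow# letter# ok# hit# : ℕ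
initial# = 1
final#   = 2
source#  = 3
label#   = 4
target#  = 5
counter# = 6
head#    = 7
next#    = 8
depth#   = 9
stack#   = 10
top#     = 11
found#   = 12
state#   = 13
edge#    = 14
child#   = 15
trial#   = 16
letters# = 17
row#     = 18
newRow#  = 19
letter#  = 20
ok#      = 21
hit#     = 22

counter states# edges# : Expr
counter = var counter#
states# = read 0 (lit 0)
edges#  = read 0 (lit 1)

decr incr : Expr → Expr
decr e = op sub e (lit 1)
incr e = op add e (lit 1)

listEdge : Block
listEdge =
  assign next# counter (read head# (read source# counter)) ∷
  assign head# (read source# counter) (incr counter) ∷ []

visitState : Expr → Expr → Block
visitState q d =
  assign depth# q d ∷
  assign stack# (var top#) q ∷
  set top# (incr (var top#)) ∷ []

visitInitial : Block
visitInitial = branch (read initial# counter) (visitState counter (lit 1)) [] ∷ []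

-- If there is an unused transition from the top of the stack, use it; otherwise
-- pop the state, which is the moment at which it is checked for being final.
searchStep : Block
searchStep =
  set state# (read stack# (decr (var top#))) ∷
  set edge# (read head# (var state#)) ∷
  branch (var edge#)
    (assign head# (var state#) (read next# (decr (var edge#))) ∷
     set child# (read target# (decr (var edge#))) ∷
     branch (read depth# (var child#))
       []
       (visitState (var child#) (incr (read depth# (var state#)))) ∷ [])
    (branch (read final# (var state#)) (set found# (read depth# (var state#)) ∷ []) [] ∷
     set top# (decr (var top#)) ∷ []) ∷ []

search : Block
search =
  set counter# edges# ∷
  for counter# listEdge ∷
  set counter# states# ∷
  for counter# visitInitial ∷
  while (var top#) searchStep ∷ []

-- In a trial, newRow# starts as the set of final states.  For each letter, it
-- is moved to row#, and the sources of the transitions with this letter into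
-- row# are collected in newRow#.  In the end, the trial succeeds if newRow# contains an
-- initial state.  If no accepted word was found, decr (var found#) is 0
-- because subtraction is truncated.
loadFinal shiftRow scanEdges markInitial letterStep trial sampling : Block

loadFinal = assign newRow# counter (read final# counter) ∷ []

shiftRow =
  assign row# counter (read newRow# counter) ∷
  assign newRow# counter (lit 0) ∷ []

scanEdges =
  branch (op mul (op eq (read label# counter) (var letter#)) (read row# (read target# counter)))
    (assign newRow# (read source# counter) (lit 1) ∷ [])
    [] ∷ []

letterStep =
  symbol letter# (lit 0) ∷
  set counter# states# ∷
  for counter# shiftRow ∷
  set counter# edges# ∷
  for counter# scanEdges ∷ []

markInitial =
  branch (op mul (read initial# counter) (read newRow# counter))
    (set hit# (lit 1) ∷ [])
    [] ∷ []

trial =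
  set counter# states# ∷
  for counter# loadFinal ∷
  set letters# (decr (var found#)) ∷
  for letters# letterStep ∷
  set hit# (lit 0) ∷
  set counter# states# ∷
  for counter# markInitial ∷
  branch (var hit#) [] (set ok# (lit 0) ∷ []) ∷ []

-- Cells 3 and 4 of array 0 are the numerator and the denominator of ε.
sampling =
  set ok# (lit 1) ∷
  set trial# (incr (op div (op mul (lit 3) (read 0 (lit 4))) (read 0 (lit 3)))) ∷
  for trial# trial ∷
  assign 0 (lit 0) (var ok#) ∷ []

program : Block
program = search ++ sampling

-- Depth-first search

isUnvisited : ℕ → ℕ
isUnvisited zero    = 1
isUnvisited (suc _) = 0

module Search {s : ℕ} (G : Graph s) where
  open Graph G

  -- The contribution of a state to the number of remaining search steps.
  potential : (ℕ → List ℕ) → (ℕ → ℕ) → ℕ → ℕ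
  potential pend D q = isUnvisited (D q) + length (pend q)

  -- The search invariant.  Here pend q are the unused transitions from q, qs is
  -- the stack, D is the array depth#, and n is the number of remaining steps.
  record Invariant (pend : ℕ → List ℕ) (qs : List ℕ) (head next D cell : ℕ → ℕ)
                   (top found n : ℕ) : Set where
    field
      chain   : ∀ q → Chain next (head q) (pend q)
      pend⊆   : ∀ q {t} → t ∈ pend q → t < m × src t ≡ q
      stack   : Stack cell top qs
      live    : ∀ {q} → q ∈ qs → q < N × D q ≢ 0
      -- A visited state that has left the stack has been exhausted and checked.
      done    : ∀ q → D q ≢ 0 → q ∈ qs ⊎ (pend q ≡ [] × (fin q ≢ 0 → found ≢ 0))
      sound   : ∀ q {d} → D q ≡ suc d → Hits d q
      foundOK : ∀ {d} → found ≡ suc d → d ≤ N + m × ∃ λ u → Accepted u × length u ≡ d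
      -- Each step increases the greatest depth by at most one and decreases n by
      -- one.  This bounds all path lengths by the size of the graph.
      depth   : ∀ q → D q + n ≤ suc (N + m)
      measure : n ≡ sumTo N (potential pend D) + top

  -- Visiting a state turns its contribution as an unvisited state into one as a
  -- stacked state, so n does not change.
  visit : ∀ {pend qs head next D cell top found n y d} →
          Invariant pend qs head next D cell top found n →
          y < N → D y ≡ 0 → Hits d y → suc d + n ≤ suc (N + m) →
          Invariant pend (y ∷ qs) head next (upd D y (suc d)) (upd cell top y) (suc top) found n
  visit {pend} {qs} {D = D} {cell} {top} {found} {n} {y} {d} I y<N Dy hits bound = record
    { chain   = chain
    ; pend⊆   = pend⊆
    ; stack   = push (upd-same cell top y) (Stack-upd top y ≤-refl stack)
    ; live    = λ { (here refl) → y<N , λ e → 0≢1+n (trans (sym e) (upd-same D y (suc d)))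
                  ; (there q∈)  → proj₁ (live q∈) ,
                                  upd-elim (λ q v → D q ≢ 0 → v ≢ 0) D y (suc d)
                                    (λ _ ()) (λ _ _ ne → ne) _ (proj₂ (live q∈)) }
    ; done    = upd-elim (λ q v → v ≢ 0 → q ∈ y ∷ qs ⊎ (pend q ≡ [] × (fin q ≢ 0 → found ≢ 0)))
                  D y (suc d) (λ _ → inj₁ (here refl))
                  λ q _ ne → case (done q ne)
    ; sound   = λ q {e} → upd-elim (λ q v → v ≡ suc e → Hits e q) D y (suc d)
                  (λ { refl → hits }) (λ q _ → sound q) q
    ; foundOK = foundOK
    ; depth   = upd-elim (λ _ v → v + n ≤ suc (N + m)) D y (suc d) bound (λ q _ → depth q)
    ; measure = trans measure (trans
        (cong (_+ top) (sumTo-suc N y y<N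
          (cong (λ u → isUnvisited u + length (pend y)) Dy ⨾
           cong (λ v → suc (isUnvisited v + length (pend y))) (sym (upd-same D y (suc d))))
          λ i i≢y → cong (λ v → isUnvisited v + length (pend i)) (sym (upd-other D y (suc d) i≢y))))
        (sym (+-suc _ top)))
    }
    where
    open Invariant I
    _⨾_ = trans
    case : ∀ {q} {P : Set} → q ∈ qs ⊎ P → q ∈ y ∷ qs ⊎ P
    case (inj₁ q∈) = inj₁ (there q∈)
    case (inj₂ p)  = inj₂ p

  consume : ∀ {pend q qs head next D cell top found n t ts} →
          Invariant pend (q ∷ qs) head next D cell top found n → pend q ≡ t ∷ ts →
          ∃ λ n′ → n ≡ suc n′ ×
          Invariant (upd pend q ts) (q ∷ qs) (upd head q (next t)) next D cell top found n′
  consume {pend} {q} {qs} {head} {next} {D} {top = top} {found} {n} {t} {ts} I ev = _ , n≡ , record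
    { chain   = λ r → go r
    ; pend⊆   = upd-elim (λ r us → ∀ {u} → u ∈ us → u < m × src u ≡ r) pend q ts
                  (λ u∈ → pend⊆ q (subst (_ ∈_) (sym ev) (there u∈))) (λ r _ → pend⊆ r)
    ; stack   = stack
    ; live    = live
    ; done    = upd-elim (λ r us → D r ≢ 0 → r ∈ q ∷ qs ⊎ (us ≡ [] × (fin r ≢ 0 → found ≢ 0)))
                  pend q ts (λ _ → inj₁ (here refl)) (λ r _ → done r)
    ; sound   = sound
    ; foundOK = foundOK
    ; depth   = λ r → ≤-trans (+-monoʳ-≤ (D r) (≤-trans (n≤1+n _) (≤-reflexive (sym n≡)))) (depth r)
    ; measure = refl
    }
    where
    open Invariant I
    n≡ : n ≡ suc (sumTo N (potential (upd pend q ts) D) + top)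
    n≡ = trans measure (cong (_+ top) (sumTo-suc N q (proj₁ (live (here refl)))
      (trans (cong (λ us → isUnvisited (D q) + length us) ev)
        (trans (+-suc _ (length ts))
          (cong (λ us → suc (isUnvisited (D q) + length us)) (sym (upd-same pend q ts)))))
      λ i i≢q → cong (λ us → isUnvisited (D i) + length us) (sym (upd-other pend q ts i≢q))))
    tail : ∀ {h} → Chain next h (t ∷ ts) → Chain next (next t) ts
    tail (link ch) = ch
    go : ∀ r → Chain next (upd head q (next t) r) (upd pend q ts r)
    go r with r ≟ q
    ... | yes refl rewrite upd-same head q (next t) | upd-same pend q ts =
          tail (subst (Chain next (head q)) ev (chain q))
    ... | no r≢q rewrite upd-other head q (next t) r≢q | upd-other pend q ts r≢q = chain r

  pop : ∀ {pend q qs head next D cell top found found′ n} →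
        Invariant pend (q ∷ qs) head next D cell (suc top) found n → pend q ≡ [] →
        (fin q ≢ 0 × found′ ≡ D q) ⊎ (fin q ≡ 0 × found′ ≡ found) →
        ∃ λ n′ → n ≡ suc n′ × Invariant pend qs head next D cell top found′ n′
  pop {pend} {q} {qs} {D = D} {cell} {top} {found} {found′} {n} I ev new = _ , n≡ , record
    { chain   = chain
    ; pend⊆   = pend⊆
    ; stack   = rest stack
    ; live    = live ∘ there
    ; done    = λ r ne → done′ r (done r ne)
    ; sound   = sound
    ; foundOK = foundOK′ new
    ; depth   = λ r → ≤-trans (+-monoʳ-≤ (D r) (≤-trans (n≤1+n _) (≤-reflexive (sym n≡)))) (depth r)
    ; measure = refl
    }
    where
    open Invariant I
    n≡ : n ≡ suc (sumTo N (potential pend D) + top)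
    n≡ = trans measure (+-suc _ top)
    rest : ∀ {k} → Stack cell (suc k) (q ∷ qs) → Stack cell k qs
    rest (push _ st) = st
    New = (fin q ≢ 0 × found′ ≡ D q) ⊎ (fin q ≡ 0 × found′ ≡ found)
    found≢0 : New → found ≢ 0 → found′ ≢ 0
    found≢0 (inj₁ (_ , refl)) _  = proj₂ (live (here refl))
    found≢0 (inj₂ (_ , refl)) ne = ne
    here≢0 : New → fin q ≢ 0 → found′ ≢ 0
    here≢0 (inj₁ (_ , refl)) _  = proj₂ (live (here refl))
    here≢0 (inj₂ (fq , _))   ne = ⊥-elim (ne fq)
    done′ : ∀ r → r ∈ q ∷ qs ⊎ (pend r ≡ [] × (fin r ≢ 0 → found ≢ 0)) →
            r ∈ qs ⊎ (pend r ≡ [] × (fin r ≢ 0 → found′ ≢ 0))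
    done′ r (inj₁ (here refl)) = inj₂ (ev , here≢0 new)
    done′ r (inj₁ (there r∈))  = inj₁ r∈
    done′ r (inj₂ (pr , fr))   = inj₂ (pr , found≢0 new ∘ fr)
    foundOK′ : New → ∀ {d} → found′ ≡ suc d → d ≤ N + m × ∃ λ u → Accepted u × length u ≡ d
    foundOK′ (inj₂ (_ , refl)) e = foundOK e
    foundOK′ (inj₁ (fq , refl)) {d} e =
      ≤-pred (≤-trans (≤-reflexive (sym e)) (≤-trans (m≤m+n (D q) n) (depth q))) ,
      (let u , acc , len = sound q e [] fq in u , acc , trans len (+-identityʳ d))

  -- What the search establishes about the candidate L for the word length.
  Outcome : ℕ → Set
  Outcome L = L ≤ N + m ×
    ((∃ λ u → Accepted u × length u ≡ L) ⊎ (L ≡ 0 × ∀ w → ¬ Accepted w))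

  outcome : ∀ {pend head next D cell found n} →
            Invariant pend [] head next D cell 0 found n →
            (∀ {t} → t < m → t ∈ pend (src t) ⊎ D (tgt t) ≢ 0) →
            (∀ {q} → q < N → init q ≢ 0 → D q ≢ 0) →
            Outcome (found ∸ 1)
  outcome {pend} {D = D} {found = found} I targets initials = go found refl
    where
    open Invariant I
    finished : ∀ q → D q ≢ 0 → pend q ≡ [] × (fin q ≢ 0 → found ≢ 0)
    finished q ne with done q ne
    ... | inj₂ p = p
    -- The visited states are closed under transitions, so a word accepted from
    -- one of them ends in a visited final state.
    closed : ∀ w {q} → D q ≢ 0 → Acc w q → found ≢ 0
    closed []      ne fq = proj₂ (finished _ ne) fq
    closed (c ∷ w) ne (t , t<m , refl , _ , acc) with targets t<m
    ... | inj₂ ne′ = closed w ne′ acc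
    ... | inj₁ t∈ with pend (src t) | proj₁ (finished (src t) ne)
    closed (c ∷ w) ne (t , t<m , refl , _ , acc) | inj₁ () | .[] | refl
    go : ∀ f → found ≡ f → Outcome (f ∸ 1)
    go zero    e = z≤n , inj₂ (refl , λ w (q , q<N , iq , acc) → closed w (initials q<N iq) acc e)
    go (suc d) e = let d≤ , u = foundOK e in d≤ , inj₁ u

-- Execution of the search

module SearchExecution {s : ℕ} .{{_ : NonZero s}} (G : Graph s) (ε₁ ε₂ : ℕ) where
  open Graph G
  open Search G
  open Logic s
  open Loops s

  Input : State → Set
  Input σ = Inputs ε₁ ε₂ (σ 0) (σ 1) (σ 2) (σ 3) (σ 4) (σ 5)

  InvariantAt : (ℕ → List ℕ) → List ℕ → ℕ → State → Set
  InvariantAt pend qs n σ = Invariant pend qs (σ head#) (σ next#) (σ depth#) (σ stack#) (σ top# 0) (σ found# 0) n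

  -- The transitions with numbers at least i are in the adjacency lists.  The
  -- search invariant already holds here, with no state visited.
  record Listing (i : ℕ) (σ : State) : Set where
    field
      input     : Input σ
      unvisited : ∀ q → σ depth# q ≡ 0
      {pend}    : ℕ → List ℕ
      {n}       : ℕ
      invariant : InvariantAt pend [] n σ
      measured  : n + i ≡ N + m
      i≤m       : i ≤ m
      listed    : ∀ {t} → i ≤ t → t < m → t ∈ pend (src t)
      -- Writing the link of a transition below i does not disturb the lists.
      fresh     : ∀ q {t} → t ∈ pend q → i ≤ t

  listing-starts : ∀ σ → Input σ → (∀ q → σ head# q ≡ 0) → (∀ q → σ depth# q ≡ 0) →
                   σ top# 0 ≡ 0 → σ found# 0 ≡ 0 → Listing m σ
  listing-starts σ inp head0 D0 top0 found0 = record
    { input = inp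
    ; unvisited = D0
    ; invariant = record
      { chain   = λ q → subst (λ h → Chain (σ next#) h []) (sym (head0 q)) end
      ; pend⊆   = λ _ ()
      ; stack   = subst (λ k → Stack (σ stack#) k []) (sym top0) empty
      ; live    = λ ()
      ; done    = λ q ne → ⊥-elim (ne (D0 q))
      ; sound   = λ q e → ⊥-elim (0≢1+n (trans (sym (D0 q)) e))
      ; foundOK = λ e → ⊥-elim (0≢1+n (trans (sym found0) e))
      ; depth   = λ q → subst (λ d → d + N ≤ suc (N + m)) (sym (D0 q)) (m≤n⇒m≤1+n (m≤m+n N m))
      ; measure = sym (trans (cong₂ _+_
          (trans (sumTo-cong N λ q _ → cong (λ d → isUnvisited d + 0) (D0 q)) (sumTo-1 N)) top0)
          (+-identityʳ N))
      }
    ; measured = refl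
    ; i≤m    = ≤-refl
    ; listed = λ m≤t t<m → ⊥-elim (<⇒≱ t<m m≤t)
    ; fresh  = λ _ ()
    }

  list-edge : ∀ t σ → Listing (suc t) σ → σ counter# 0 ≡ suc t →
              Det listEdge (σ [ counter# , 0 ]≔ t) 15 (λ σ′ → Listing t σ′ × σ′ counter# 0 ≡ t)
  list-edge t σ L _ post =
    assigns t (σ head# q) refl (cong (σ head#) (src≡ t)) (
    assigns q (suc t) (src≡ t) (+-comm t 1) (
    post _ (record
      { input = input
      ; unvisited = unvisited
      ; invariant = record
        { chain   = chain′
        ; pend⊆   = upd-elim (λ r us → ∀ {u} → u ∈ us → u < m × src u ≡ r) pend q (t ∷ pend q)
                      (λ { (here refl) → i≤m , refl ; (there u∈) → pend⊆ q u∈ })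
                      (λ r _ → pend⊆ r)
        ; stack   = stack
        ; live    = live
        ; done    = λ r ne → ⊥-elim (ne (unvisited r))
        ; sound   = sound
        ; foundOK = foundOK
        ; depth   = λ r → subst (λ d → d + suc n ≤ suc (N + m)) (sym (unvisited r))
                      (s≤s (≤-trans (m≤m+n n (suc t)) (≤-reflexive measured)))
        ; measure = trans (cong suc measure) (cong (_+ σ top# 0) (sym
            (sumTo-suc N q (src< i≤m)
              (trans (cong (λ us → isUnvisited (σ depth# q) + length us)
                           (upd-same pend q (t ∷ pend q)))
                     (+-suc _ _))
              λ r r≢q → cong (λ us → isUnvisited (σ depth# r) + length us)
                           (upd-other pend q (t ∷ pend q) r≢q))))
        }
      ; measured = trans (sym (+-suc n t)) measured
      ; i≤m    = <⇒≤ i≤m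
      ; listed = λ {u} t≤u u<m → listed′ u t≤u u<m
      ; fresh  = upd-elim (λ r us → ∀ {u} → u ∈ us → t ≤ u) pend q (t ∷ pend q)
                   (λ { (here refl) → ≤-refl ; (there u∈) → <⇒≤ (fresh q u∈) })
                   (λ r _ u∈ → <⇒≤ (fresh r u∈))
      } , refl)))
    where
    open Listing L
    open Invariant invariant
    open Inputs input
    q = src t
    pend′ = upd pend q (t ∷ pend q)
    older : ∀ r → Chain (upd (σ next#) t (σ head# q)) (σ head# r) (pend r)
    older r = Chain-upd t _ (λ u∈ → >⇒≢ (fresh r u∈)) (chain r)
    chain′ : ∀ r → Chain (upd (σ next#) t (σ head# q)) (upd (σ head#) q (suc t) r) (pend′ r)
    chain′ r with r ≟ q
    ... | no r≢q rewrite upd-other (σ head#) q (suc t) r≢q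
                       | upd-other pend q (t ∷ pend q) r≢q = older r
    ... | yes refl rewrite upd-same (σ head#) q (suc t) | upd-same pend q (t ∷ pend q) =
          link (subst (λ h → Chain (upd (σ next#) t (σ head# q)) h (pend q)) (sym (upd-same (σ next#) t (σ head# q))) (older q))
    listed′ : ∀ u → t ≤ u → u < m → u ∈ pend′ (src u)
    listed′ u t≤u u<m = upd-elim (λ r us → src u ≡ r → u ∈ us) pend q (t ∷ pend q)
      (case (m≤n⇒m<n∨m≡n t≤u)) (λ { r r≢q refl → old (m≤n⇒m<n∨m≡n t≤u) r≢q }) (src u) refl
      where
      case : t < u ⊎ t ≡ u → src u ≡ q → u ∈ t ∷ pend q
      case (inj₂ refl) _ = here refl
      case (inj₁ t<u) e = there (subst (λ r → u ∈ pend r) e (listed t<u u<m))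
      old : t < u ⊎ t ≡ u → src u ≢ q → u ∈ pend (src u)
      old (inj₁ t<u) _  = listed t<u u<m
      old (inj₂ refl) ne = ⊥-elim (ne refl)

  -- The initial states with numbers at least i have been visited.
  record Starting (i : ℕ) (σ : State) : Set where
    field
      input     : Input σ
      {pend}    : ℕ → List ℕ
      {qs}      : List ℕ
      invariant : InvariantAt pend qs (N + m) σ
      i≤N       : i ≤ N
      unvisited : ∀ {q} → q < i → σ depth# q ≡ 0
      visited   : ∀ {q} → i ≤ q → q < N → init q ≢ 0 → σ depth# q ≢ 0
      targets   : ∀ {t} → t < m → t ∈ pend (src t)

  starting-starts : ∀ σ → Listing 0 σ → Starting N (σ [ counter# , 0 ]≔ N)
  starting-starts σ L = record
    { input     = input
    ; invariant = subst (λ n → InvariantAt _ _ n σ) (trans (sym (+-identityʳ n)) measured) invariant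
    ; i≤N       = ≤-refl
    ; unvisited = λ _ → unvisited _
    ; visited   = λ N≤q q<N → ⊥-elim (<⇒≱ q<N N≤q)
    ; targets   = listed z≤n
    }
    where open Listing L

  visit-initial : ∀ q σ → Starting (suc q) σ → σ counter# 0 ≡ suc q →
    Det visitInitial (σ [ counter# , 0 ]≔ q) 19 (λ σ′ → Starting q σ′ × σ′ counter# 0 ≡ q)
  visit-initial q σ S _ {T = T} post with init q ≟ 0
  ... | yes iq =
    weaken (m≤n+m (4 + T) 15) (branches-else (trans (init≡ q) iq) (post _ (record
      { input     = input
      ; invariant = invariant
      ; i≤N       = <⇒≤ i≤N
      ; unvisited = λ r<q → unvisited (m<n⇒m<1+n r<q)
      ; visited   = λ q≤r r<N ir → visited (≤∧≢⇒< q≤r λ { refl → ir iq }) r<N ir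
      ; targets   = targets
      } , refl)))
    where
    open Starting S
    open Inputs input
  ... | no iq = branches-then (λ e → iq (trans (sym (init≡ q)) e)) (
    assigns q 1 refl refl (
    assigns (σ top# 0) q refl refl (
    assigns 0 (suc (σ top# 0)) refl (+-comm (σ top# 0) 1) (
    post _ (record
      { input     = input
      ; invariant = visit invariant i≤N (unvisited (n<1+n q)) (Hits-initial i≤N iq) ≤-refl
      ; i≤N       = <⇒≤ i≤N
      ; unvisited = λ r<q → trans (upd-other (σ depth#) q 1 (<⇒≢ r<q)) (unvisited (m<n⇒m<1+n r<q))
      ; visited   = λ {r} → upd-elim (λ r v → q ≤ r → r < N → init r ≢ 0 → v ≢ 0) (σ depth#) q 1
                      (λ _ _ _ ())
                      (λ r r≢q q≤r → visited (≤∧≢⇒< q≤r (r≢q ∘ sym))) r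
      ; targets   = targets
      } , refl)))))
    where
    open Starting S
    open Inputs input

  -- The invariant of the main loop.  In addition to the search invariant, the
  -- initial states are visited, and every transition is unused or has a visited
  -- target.
  record Searching (n : ℕ) (σ : State) : Set where
    field
      input     : Input σ
      {pend}    : ℕ → List ℕ
      {qs}      : List ℕ
      invariant : InvariantAt pend qs n σ
      initials  : ∀ {q} → q < N → init q ≢ 0 → σ depth# q ≢ 0
      targets   : ∀ {t} → t < m → t ∈ pend (src t) ⊎ σ depth# (tgt t) ≢ 0

  searching-starts : ∀ σ → Starting 0 σ → Searching (N + m) σ
  searching-starts σ S = record
    { input = input ; invariant = invariant ; initials = visited z≤n ; targets = inj₁ ∘ targets }
    where open Starting S

  search-step : ∀ n σ → Searching n σ → σ top# 0 ≢ 0 →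
                ∃ λ n′ → n ≡ suc n′ × Det searchStep σ 53 (Searching n′)
  search-step n σ S top≢0 = go (σ top# 0) qs refl invariant
    where
    open Searching S
    open Invariant invariant
    open Inputs input

    Goal : Set
    Goal = ∃ λ n′ → n ≡ suc n′ × Det searchStep σ 53 (Searching n′)

    chain-nil : ∀ {h} → Chain (σ next#) h [] → h ≡ 0
    chain-nil end = refl
    chain-cons : ∀ {h t ts} → Chain (σ next#) h (t ∷ ts) → h ≡ suc t
    chain-cons (link _) = refl
    cell-top : ∀ {k q qs} → Stack (σ stack#) (suc k) (q ∷ qs) → σ stack# k ≡ q
    cell-top (push e _) = e

    module Step {k q qs} (topk : σ top# 0 ≡ suc k) (I : InvariantAt pend (q ∷ qs) n σ) where
      open Invariant I using () renaming (stack to stackI; live to liveI; chain to chainI)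

      top≡ : σ stack# (σ top# 0 ∸ 1) ≡ q
      top≡ = trans (cong (λ k → σ stack# (k ∸ 1)) topk)
                   (cell-top (subst (λ k → Stack (σ stack#) k (q ∷ qs)) topk stackI))

      I′ : Invariant pend (q ∷ qs) (σ head#) (σ next#) (σ depth#) (σ stack#) (suc k) (σ found# 0) n
      I′ = subst (λ k → Invariant pend (q ∷ qs) (σ head#) (σ next#) (σ depth#) (σ stack#) k (σ found# 0) n) topk I

      pops : pend q ≡ [] → Goal
      pops pq = go (fin q ≟ 0)
        where
        head≡ : σ head# q ≡ 0
        head≡ = chain-nil (subst (Chain (σ next#) (σ head# q)) pq (chainI q))
        go : _ → Goal
        go (yes fq) =
          let n′ , n≡ , J = pop I′ pq (inj₂ (fq , refl))
          in n′ , n≡ , λ {k′} {T} post → weaken (m≤n+m (25 + T) 28) (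
            assigns 0 q refl top≡ (
            assigns 0 0 refl head≡ (
            branches-else refl (
            branches-else (trans (fin≡ q) fq) (
            assigns 0 k refl (cong (_∸ 1) topk) (
            post _ (record { input = input ; invariant = J ; initials = initials ; targets = targets })))))))
        go (no fq) =
          let n′ , n≡ , J = pop I′ pq (inj₁ (fq , refl))
          in n′ , n≡ , λ {k′} {T} post → weaken (m≤n+m (30 + T) 23) (
            assigns 0 q refl top≡ (
            assigns 0 0 refl head≡ (
            branches-else refl (
            branches-then (λ e → fq (trans (sym (fin≡ q)) e)) (
            assigns 0 (σ depth# q) refl refl (
            assigns 0 k refl (cong (_∸ 1) topk) (
            post _ (record { input = input ; invariant = J ; initials = initials ; targets = targets }))))))))

      consumes : ∀ {t ts} → pend q ≡ t ∷ ts → Goal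
      consumes {t} {ts} pq = go (σ depth# (tgt t)) refl
        where
        head≡ : σ head# q ≡ suc t
        head≡ = chain-cons (subst (Chain (σ next#) (σ head# q)) pq (chainI q))
        t<m,src≡ : t < m × src t ≡ q
        t<m,src≡ = Invariant.pend⊆ I q (subst (t ∈_) (sym pq) (here refl))
        -- Transition t may leave the list of q once its target is visited.
        targets′ : ∀ (D : ℕ → ℕ) → (∀ r → σ depth# r ≢ 0 → D r ≢ 0) → D (tgt t) ≢ 0 →
                   ∀ {u} → u < m → u ∈ upd pend q ts (src u) ⊎ D (tgt u) ≢ 0
        targets′ D mono ne {u} u<m with targets u<m
        ... | inj₂ ne′ = inj₂ (mono (tgt u) ne′)
        ... | inj₁ u∈  = upd-elim (λ r us → u ∈ pend r → u ∈ us ⊎ D (tgt u) ≢ 0) pend q ts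
              (λ u∈ → split (subst (u ∈_) pq u∈)) (λ _ _ → inj₁) (src u) u∈
          where
          split : u ∈ t ∷ ts → u ∈ ts ⊎ D (tgt u) ≢ 0
          split (here refl) = inj₂ ne
          split (there u∈)  = inj₁ u∈
        go : ∀ d → σ depth# (tgt t) ≡ d → Goal
        go (suc d) Dy =
          let n′ , n≡ , J = consume I pq
          in n′ , n≡ , λ {k′} {T} post → weaken (m≤n+m (34 + T) 19) (
            assigns 0 q refl top≡ (
            assigns 0 (suc t) refl head≡ (
            branches-then (λ ()) (
            assigns q (σ next# t) refl refl (
            assigns 0 (tgt t) refl (tgt≡ t) (
            branches-then ne (
            post _ (record { input = input ; invariant = J ; initials = initials
                           ; targets = targets′ (σ depth#) (λ _ ne → ne) ne }))))))))
          where
          ne : σ depth# (tgt t) ≢ 0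
          ne e = 0≢1+n (trans (sym e) Dy)
        go zero Dy = go′ (σ depth# q) refl
          where
          y = tgt t
          go′ : ∀ d → σ depth# q ≡ d → Goal
          go′ zero Dq = ⊥-elim (proj₂ (liveI (here refl)) Dq)
          go′ (suc d) Dq =
            let n′ , n≡ , J = consume I pq
                t<m , src≡q = t<m,src≡
                hits = Hits-edge t<m (subst (Hits d) (sym src≡q) (Invariant.sound J q Dq))
                bound = ≤-trans (≤-reflexive (trans (sym (+-suc (suc d) n′)) (cong₂ _+_ (sym Dq) (sym n≡))))
                                (Invariant.depth I q)
            in n′ , n≡ , λ {k′} {T} post →
            assigns 0 q refl top≡ (
            assigns 0 (suc t) refl head≡ (
            branches-then (λ ()) (
            assigns q (σ next# t) refl refl (
            assigns 0 y refl (tgt≡ t) (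
            branches-else Dy (
            assigns y (suc (suc d)) refl (trans (cong (_+ 1) Dq) (+-comm (suc d) 1)) (
            assigns (σ top# 0) y refl refl (
            assigns 0 (suc (σ top# 0)) refl (+-comm (σ top# 0) 1) (
            post _ (record
              { input = input
              ; invariant = visit J (tgt< t<m) Dy hits bound
              ; initials = λ q<N iq → mono y d _ (initials q<N iq)
              ; targets = targets′ (upd (σ depth#) y (suc (suc d))) (mono y d)
                  (λ e → 0≢1+n (trans (sym e) (upd-same (σ depth#) y (suc (suc d)))))
              }))))))))))
            where
            mono : ∀ y d r → σ depth# r ≢ 0 → upd (σ depth#) y (suc (suc d)) r ≢ 0
            mono y d = upd-elim (λ r v → σ depth# r ≢ 0 → v ≢ 0) (σ depth#) y (suc (suc d))
                         (λ _ ()) (λ _ _ ne → ne)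

    go : ∀ k qs → σ top# 0 ≡ k → InvariantAt pend qs n σ → Goal
    go zero    _  topk I = ⊥-elim (top≢0 topk)
    go (suc k) [] topk I with () ← subst (λ k → Stack (σ stack#) k []) topk (Invariant.stack I)
    go (suc k) (q ∷ qs) topk I = case (pend q) refl
      where
      case : ∀ us → pend q ≡ us → Goal
      case []       = Step.pops topk I
      case (t ∷ ts) = Step.consumes topk I

  Searched : State → Set
  Searched σ = Input σ × Outcome (σ found# 0 ∸ 1)

  searched : ∀ {n} σ → Searching n σ → σ top# 0 ≡ 0 → Searched σ
  searched {n} σ S top0 = input , go (subst
    (λ k → Invariant pend qs (σ head#) (σ next#) (σ depth#) (σ stack#) k (σ found# 0) n) top0 invariant)
    where
    open Searching S
    go : ∀ {qs} →
         Invariant pend qs (σ head#) (σ next#) (σ depth#) (σ stack#) 0 (σ found# 0) n →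
         Outcome (σ found# 0 ∸ 1)
    go {[]}    I = outcome I targets initials
    go {_ ∷ _} I with () ← Invariant.stack I

  searchTime : ℕ
  searchTime = 4 + ((m * 24 + 3) + (4 + ((N * 28 + 3) + ((N + m) * 56 + 3))))

  search-executes : ∀ σ → Input σ → (∀ q → σ head# q ≡ 0) → (∀ q → σ depth# q ≡ 0) →
                    σ top# 0 ≡ 0 → σ found# 0 ≡ 0 → Det search σ searchTime Searched
  search-executes σ inp head0 D0 top0 found0 {T = T} post =
    weaken (≤-reflexive (reassociate (m * 24 + 3) (N * 28 + 3) ((N + m) * 56 + 3) T)) (
    assigns 0 m refl (Inputs.m≡ inp) (
    for-det {c = 15} Listing list-edge m _ (listing-starts _ inp head0 D0 top0 found0) refl λ σ₁ L →
    assigns 0 N refl (Inputs.N≡ (Listing.input L)) (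
    for-det {c = 19} Starting visit-initial N _ (starting-starts σ₁ L) refl λ σ₂ S →
    while-det {c = 53} Searching search-step (N + m) σ₂ (searching-starts σ₂ S) λ { σ₃ (_ , S₃ , top0) →
    post σ₃ (searched σ₃ S₃ top0) })))
    where
    reassociate : ∀ a b c T → 4 + (a + (4 + (b + (c + T)))) ≡ 4 + (a + (4 + (b + c))) + T
    reassociate = ℕ-Ring.solve-∀

-- Execution of the trials

-- The expected value of f (u ++ w) for a uniform word u of length j, drawn
-- from its last letter to its first.
average : ∀ {s} .{{_ : NonZero s}} → ℕ → (Word s → ℚ) → Word s → ℚ
average         zero    f w = f w
average {s = s} (suc j) f w = (+ 1 ℚ./ s) ℚ.* sum (λ c → average j f (c ∷ w))

average-scale : ∀ {s} .{{_ : NonZero s}} j x (f : Word s → ℚ) w →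
                average j (λ w → x ℚ.* f w) w ≡ x ℚ.* average j f w
average-scale zero x f w = refl
average-scale {s} (suc j) x f w = begin
  1/s ℚ.* sum (λ c → average j (λ w → x ℚ.* f w) (c ∷ w)) ≡⟨ cong (1/s ℚ.*_) (sum-cong-≗ λ c → average-scale j x f (c ∷ w)) ⟩
  1/s ℚ.* sum (λ c → x ℚ.* average j f (c ∷ w))           ≡⟨ cong (1/s ℚ.*_) (sym (*-distribˡ-sum x λ c → average j f (c ∷ w))) ⟩
  1/s ℚ.* (x ℚ.* S)                                       ≡⟨ sym (ℚ.*-assoc 1/s x S) ⟩
  1/s ℚ.* x ℚ.* S                                         ≡⟨ cong (ℚ._* S) (ℚ.*-comm 1/s x) ⟩
  x ℚ.* 1/s ℚ.* S                                         ≡⟨ ℚ.*-assoc x 1/s S ⟩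
  x ℚ.* (1/s ℚ.* S)                                       ∎
  where
  open ≡-Reasoning
  1/s = + 1 ℚ./ s
  S = sum λ c → average j f (c ∷ w)

indicator : Bool → ℚ
indicator b = if b then 1ℚ else 0ℚ

⟦eq⟧-refl : ∀ n → ⟦ eq ⟧ᵒ n n ≡ 1
⟦eq⟧-refl zero    = refl
⟦eq⟧-refl (suc n) = ⟦eq⟧-refl n

⟦eq⟧≢0⇒≡ : ∀ a b → ⟦ eq ⟧ᵒ a b ≢ 0 → a ≡ b
⟦eq⟧≢0⇒≡ a b ne with a ≡ᵇ b | ≡ᵇ⇒≡ a b
... | true  | f = f _
... | false | _ = ⊥-elim (ne refl)

module SamplingExecution {s : ℕ} .{{_ : NonZero s}} (G : Graph s) (ε₁ ε₂ L : ℕ) where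
  open Graph G
  open Logic s
  open Loops s
  open SearchExecution G ε₁ ε₂ using (Input)

  -- The row is the set of states from which w is accepted.
  record Represents (w : Word s) (row : ℕ → ℕ) : Set where
    field
      row⇒Acc : ∀ {q} → q < N → row q ≢ 0 → Acc w q
      Acc⇒row : ∀ {q} → q < N → Acc w q → row q ≢ 0

  -- The values that must survive while one word is processed: the flag o, which
  -- is nonzero as long as all trials have succeeded, and the number r of
  -- remaining trials.
  Frame : ℕ → ℕ → State → Set
  Frame o r σ = Input σ × σ found# 0 ∸ 1 ≡ L × σ ok# 0 ≡ o × σ trial# 0 ≡ r

  letterTime : ℕ
  letterTime = 2 + (4 + ((N * 19 + 3) + (4 + (m * 26 + 3))))

  trialTime : ℕ
  trialTime = 4 + ((N * 15 + 3) + (6 + ((L * (9 + letterTime) + 3) + (3 + (4 + ((N * 20 + 3) + 6))))))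

  samplingTime : ℕ → ℕ
  samplingTime n = 14 + ((n * (9 + trialTime) + 3) + 4)

  module _ {o r : ℕ} where

    -- The new row agrees with the final flags from state i onwards.
    Loading : ℕ → State → Set
    Loading i σ = Frame o r σ × (∀ {q} → i ≤ q → q < N → σ newRow# q ≡ fin q)

    load-state : ∀ i σ → Loading (suc i) σ → σ counter# 0 ≡ suc i →
      Det loadFinal (σ [ counter# , 0 ]≔ i) 6 (λ σ′ → Loading i σ′ × σ′ counter# 0 ≡ i)
    load-state i σ (frame@(inp , _) , row) _ post =
      assigns i (fin i) refl (Inputs.fin≡ inp i)
      (post _ ((frame , λ {q} → upd-elim (λ q v → i ≤ q → q < N → v ≡ fin q) (σ newRow#) i (fin i)
        (λ _ _ → refl) (λ q q≢i i≤q → row (≤∧≢⇒< i≤q (q≢i ∘ sym))) q) , refl))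

    loaded : ∀ {σ} → Loading 0 σ → Represents [] (σ newRow#)
    loaded (_ , row) = record
      { row⇒Acc = λ q<N ne e → ne (trans (row z≤n q<N) e)
      ; Acc⇒row = λ q<N ne e → ne (trans (sym (row z≤n q<N)) e)
      }

    module _ (w : Word s) (j : ℕ) (c : Fin s) where

      -- From state i onwards, the set for w has been moved from newRow# to row#.
      record Shifting (i : ℕ) (σ : State) : Set where
        field
          frame   : Frame o r σ
          letters : σ letters# 0 ≡ j
          letter  : σ letter# 0 ≡ toℕ c
          shifted : ∀ {q} → i ≤ q → q < N → σ newRow# q ≡ 0 × (σ row# q ≢ 0 → Acc w q) × (Acc w q → σ row# q ≢ 0)
          old     : ∀ {q} → q < i → q < N → (σ newRow# q ≢ 0 → Acc w q) × (Acc w q → σ newRow# q ≢ 0)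

      shift-state : ∀ i σ → Shifting (suc i) σ → σ counter# 0 ≡ suc i →
        Det shiftRow (σ [ counter# , 0 ]≔ i) 10 (λ σ′ → Shifting i σ′ × σ′ counter# 0 ≡ i)
      shift-state i σ S _ post =
        assigns i (σ newRow# i) refl refl (
        assigns i 0 refl refl (
        post _ (record
          { frame = frame ; letters = letters ; letter = letter
          ; shifted = λ {q} → shifted′ q
          ; old = λ q<i q<N → subst (λ v → (v ≢ 0 → Acc w _) × (Acc w _ → v ≢ 0))
                    (sym (upd-other (σ newRow#) i 0 (<⇒≢ q<i))) (old (m<n⇒m<1+n q<i) q<N)
          } , refl)))
        where
        open Shifting S
        shifted′ : ∀ q → i ≤ q → q < N → upd (σ newRow#) i 0 q ≡ 0 ×
                   (upd (σ row#) i (σ newRow# i) q ≢ 0 → Acc w q) ×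
                   (Acc w q → upd (σ row#) i (σ newRow# i) q ≢ 0)
        shifted′ q i≤q q<N with q ≟ i
        ... | yes refl rewrite upd-same (σ newRow#) i 0 | upd-same (σ row#) i (σ newRow# i) =
              refl , old (n<1+n i) q<N
        ... | no q≢i rewrite upd-other (σ newRow#) i 0 q≢i | upd-other (σ row#) i (σ newRow# i) q≢i =
              shifted (≤∧≢⇒< i≤q (q≢i ∘ sym)) q<N

      -- The transitions with numbers at least i have been scanned for the letter c.
      record Scanning (i : ℕ) (σ : State) : Set where
        field
          frame   : Frame o r σ
          letters : σ letters# 0 ≡ j
          letter  : σ letter# 0 ≡ toℕ c
          i≤m     : i ≤ m
          row     : Represents w (σ row#)
          sound   : ∀ {q} → σ newRow# q ≢ 0 → q < N → Acc (c ∷ w) q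
          scanned : ∀ {t} → i ≤ t → t < m → lab t ≡ toℕ c → Acc w (tgt t) → σ newRow# (src t) ≢ 0

      scanning-starts : ∀ σ → Shifting 0 σ → Scanning m (σ [ counter# , 0 ]≔ m)
      scanning-starts σ S = record
        { frame = frame ; letters = letters ; letter = letter
        ; i≤m = ≤-refl
        ; row = record
          { row⇒Acc = λ q<N → proj₁ (proj₂ (shifted z≤n q<N))
          ; Acc⇒row = λ q<N → proj₂ (proj₂ (shifted z≤n q<N)) }
        ; sound = λ ne q<N → ⊥-elim (ne (proj₁ (shifted z≤n q<N)))
        ; scanned = λ m≤t t<m → ⊥-elim (<⇒≱ t<m m≤t)
        }
        where open Shifting S

      scan-edge : ∀ t σ → Scanning (suc t) σ → σ counter# 0 ≡ suc t →
        Det scanEdges (σ [ counter# , 0 ]≔ t) 17 (λ σ′ → Scanning t σ′ × σ′ counter# 0 ≡ t)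
      scan-edge t σ S _ {T = T} post = go (test ≟ 0)
        where
        open Scanning S
        open Represents row
        open Inputs (proj₁ frame)
        test = ⟦ eq ⟧ᵒ (σ label# t) (σ letter# 0) * σ row# (σ target# t)
        test≢0 : lab t ≡ toℕ c → Acc w (tgt t) → test ≢ 0
        test≢0 l acc e = Acc⇒row (tgt< i≤m) acc (trans (cong (σ row#) (sym (tgt≡ t)))
          (trans (sym (*-identityˡ _)) (trans (cong (_* σ row# (σ target# t)) (sym
            (trans (cong₂ ⟦ eq ⟧ᵒ (trans (lab≡ t) l) letter) (⟦eq⟧-refl (toℕ c))))) e)))
        go : _ → _
        go (yes e) = weaken (m≤n+m (12 + T) 5) (branches-else e (post _ (record
          { frame = frame ; letters = letters ; letter = letter
          ; i≤m = <⇒≤ i≤m ; row = row ; sound = sound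
          ; scanned = λ {u} t≤u u<m l acc → scanned (≤∧≢⇒< t≤u (λ { refl → test≢0 l acc e })) u<m l acc
          } , refl)))
        go (no ne) = branches-then ne (
          assigns (src t) 1 (src≡ t) refl (
          post _ (record
          { frame = frame ; letters = letters ; letter = letter
          ; i≤m = <⇒≤ i≤m ; row = row
          ; sound = λ {q} → upd-elim (λ q v → v ≢ 0 → q < N → Acc (c ∷ w) q) (σ newRow#) (src t) 1
              (λ _ _ → t , i≤m , refl , label , target) (λ q _ → sound) q
          ; scanned = λ {u} t≤u u<m l acc → upd-elim (λ q v → src u ≡ q → v ≢ 0) (σ newRow#) (src t) 1
              (λ _ ())
              (λ q q≢ e → subst (λ q → σ newRow# q ≢ 0) e
                (scanned (≤∧≢⇒< t≤u (λ { refl → q≢ (sym e) })) u<m l acc)) (src u) refl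
          } , refl)))
          where
          label : lab t ≡ toℕ c
          label = trans (sym (lab≡ t)) (trans
            (⟦eq⟧≢0⇒≡ _ _ λ e → ne (cong (_* σ row# (σ target# t)) e)) letter)
          target : Acc w (tgt t)
          target = row⇒Acc (tgt< i≤m) λ e → ne (trans
            (cong (⟦ eq ⟧ᵒ (σ label# t) (σ letter# 0) *_) (trans (cong (σ row#) (tgt≡ t)) e))
            (*-zeroʳ (⟦ eq ⟧ᵒ (σ label# t) (σ letter# 0))))

      scanned-represents : ∀ {σ} → Scanning 0 σ → Represents (c ∷ w) (σ newRow#)
      scanned-represents S = record
        { row⇒Acc = λ q<N ne → sound ne q<N
        ; Acc⇒row = λ { q<N (t , t<m , refl , l , acc) → scanned z≤n t<m l acc }
        }
        where open Scanning S

    -- After some letters are drawn, giving the word w, j letters remain and True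
    -- has the conditional probability average j f w, where f is the probability
    -- given the whole word.
    Drawing : (Word s → ℚ) → ℕ → State → ℚ → Set
    Drawing f j σ p = Frame o r σ × ∃ λ w → Represents w (σ newRow#) × p ≡ average j f w

    draw-letter : ∀ f j σ p → Drawing f (suc j) σ p → σ letters# 0 ≡ suc j →
      Spec letterStep (σ [ letters# , 0 ]≔ j) letterTime p
        (λ σ′ p′ → Drawing f j σ′ p′ × σ′ letters# 0 ≡ j)
    draw-letter f j σ _ (frame , w , rep , refl) _ {T = T} post =
      weaken (≤-reflexive (reassociate (N * 19 + 3) (m * 26 + 3) T)) (
      selects 0 refl λ c →
      assigns 0 N refl (Inputs.N≡ (proj₁ frame)) (
      for-det {c = 10} (Shifting w j c) (shift-state w j c) N _ (record
        { frame = frame ; letters = refl ; letter = refl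
        ; shifted = λ N≤q q<N → ⊥-elim (<⇒≱ q<N N≤q)
        ; old = λ _ q<N → row⇒Acc q<N , Acc⇒row q<N }) refl λ σ₁ S →
      assigns 0 m refl (Inputs.m≡ (proj₁ (Shifting.frame S))) (
      for-det {c = 17} (Scanning w j c) (scan-edge w j c) m _ (scanning-starts w j c σ₁ S) refl λ σ₂ S₂ →
      post σ₂ _ ((Scanning.frame S₂ , c ∷ w , scanned-represents w j c S₂ , refl) , Scanning.letters S₂))))
      where
      open Represents rep
      reassociate : ∀ a b T → 2 + (4 + (a + (4 + (b + T)))) ≡ 2 + (4 + (a + (4 + b))) + T
      reassociate = ℕ-Ring.solve-∀

    -- The initial states with numbers at least i have been compared with newRow#.
    record Marking (w : Word s) (i : ℕ) (σ : State) : Set where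
      field
        frame  : Frame o r σ
        i≤N    : i ≤ N
        row    : Represents w (σ newRow#)
        sound  : σ hit# 0 ≢ 0 → Accepted w
        marked : ∀ {q} → i ≤ q → q < N → init q ≢ 0 → Acc w q → σ hit# 0 ≢ 0

    mark-state : ∀ w i σ → Marking w (suc i) σ → σ counter# 0 ≡ suc i →
      Det markInitial (σ [ counter# , 0 ]≔ i) 11 (λ σ′ → Marking w i σ′ × σ′ counter# 0 ≡ i)
    mark-state w i σ M _ {T = T} post = go (σ initial# i * σ newRow# i ≟ 0)
      where
      open Marking M
      open Represents row
      open Inputs (proj₁ frame)
      go : _ → _
      go (yes e) = weaken (m≤n+m (8 + T) 3) (branches-else e (post _ (record
        { frame = frame ; i≤N = <⇒≤ i≤N ; row = row ; sound = sound
        ; marked = λ i≤q q<N iq acc → marked (≤∧≢⇒< i≤q (λ { refl → nz iq acc })) q<N iq acc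
        } , refl)))
        where
        nz : init i ≢ 0 → Acc w i → ⊥
        nz iq acc with m*n≡0⇒m≡0∨n≡0 (σ initial# i) e
        ... | inj₁ e₁ = iq (trans (sym (init≡ i)) e₁)
        ... | inj₂ e₂ = Acc⇒row i≤N acc e₂
      go (no ne) = branches-then ne (
        assigns 0 1 refl refl (
        post _ (record
        { frame = frame ; i≤N = <⇒≤ i≤N ; row = row
        ; sound = λ _ → i , i≤N , (λ e → ne (cong (_* σ newRow# i) (trans (init≡ i) e))) ,
            row⇒Acc i≤N (λ e → ne (trans (cong (σ initial# i *_) e) (*-zeroʳ (σ initial# i))))
        ; marked = λ _ _ _ _ ()
        } , refl)))

    -- The result of a trial in which the word w was drawn.
    Tried : (Word s → ℚ) → State → ℚ → Set
    Tried f σ p = ∃ λ w → p ≡ f w × ((Accepted w × Frame o r σ) ⊎ (¬ Accepted w × Frame 0 r σ))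

    trial-executes : ∀ f σ → Frame o r σ → Spec trial σ trialTime (average L f []) (Tried f)
    trial-executes f σ frame {T = T} post =
      weaken (≤-reflexive (reassociate (N * 15 + 3) (L * (9 + letterTime) + 3) (N * 20 + 3) T)) (
      assigns 0 N refl (Inputs.N≡ (proj₁ frame)) (
      for-det {c = 6} Loading load-state N _ (frame , λ N≤q q<N → ⊥-elim (<⇒≱ q<N N≤q)) refl λ σ₁ l →
      assigns 0 L refl (proj₁ (proj₂ (proj₁ l))) (
      for-spec {c = letterTime} (Drawing f) (draw-letter f) L _ _ (proj₁ l , [] , loaded {σ₁} l , refl) refl
        λ { σ₂ _ (frame₂ , w , rep , refl) →
      assigns 0 0 refl refl (
      assigns 0 N refl (Inputs.N≡ (proj₁ frame₂)) (
      for-det {c = 11} (Marking w) (mark-state w) N _ (record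
        { frame = frame₂ ; i≤N = ≤-refl ; row = rep ; sound = λ ne → ⊥-elim (ne refl)
        ; marked = λ N≤q q<N → ⊥-elim (<⇒≱ q<N N≤q) }) refl λ σ₃ M →
      finish w σ₃ M (σ₃ hit# 0 ≟ 0))) })))
      where
      reassociate : ∀ a b c T → 4 + (a + (6 + (b + (3 + (4 + (c + (6 + T))))))) ≡
                    4 + (a + (6 + (b + (3 + (4 + (c + 6)))))) + T
      reassociate = ℕ-Ring.solve-∀
      finish : ∀ w σ₃ → Marking w 0 σ₃ → Dec (σ₃ hit# 0 ≡ 0) → Execution _ σ₃ (6 + T) (f w)
      finish w σ₃ M (yes e) = branches-else e (assigns 0 0 refl refl (
        let inp , l , _ , t = Marking.frame M in
        post _ _ (w , refl , inj₂ ((λ (q , q<N , iq , acc) → Marking.marked M z≤n q<N iq acc e) ,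
                                   (inp , l , refl , t)))))
      finish w σ₃ M (no ne) = weaken (m≤n+m (3 + T) 3) (branches-then ne (
        post _ _ (w , refl , inj₁ (Marking.sound M ne , Marking.frame M))))

  module _ (accepted? : ∀ w → Dec (Accepted w)) where

    acceptance : Word s → ℚ
    acceptance w = indicator (does (accepted? w))

    -- The probability that a trial succeeds.
    β : ℚ
    β = average L acceptance []

    weight : ℕ → ℚ
    weight o = indicator (nonzero o)

    -- With i trials remaining, the answer will be True with probability β ^ i if
    -- no trial has failed, and 0 otherwise.
    Trying : ℕ → State → ℚ → Set
    Trying i σ p = Input σ × σ found# 0 ∸ 1 ≡ L × p ≡ weight (σ ok# 0) ℚ.* β ^ℚ i

    try : ∀ i σ p → Trying (suc i) σ p → σ trial# 0 ≡ suc i →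
      Spec trial (σ [ trial# , 0 ]≔ i) trialTime p (λ σ′ p′ → Trying i σ′ p′ × σ′ trial# 0 ≡ i)
    try i σ _ (inp , l , refl) _ post =
      subst (Execution _ _ _) (trans (average-scale L x acceptance []) (trans
        (ℚ.*-assoc (weight (σ ok# 0)) (β ^ℚ i) β)
        (cong (weight (σ ok# 0) ℚ.*_) (ℚ.*-comm (β ^ℚ i) β)))) (
      trial-executes (λ w → x ℚ.* acceptance w) (σ [ trial# , 0 ]≔ i) (inp , l , refl , refl)
        λ σ′ p′ → λ { (w , refl , case) → post σ′ _ (after σ′ w case (accepted? w)) })
      where
      x = weight (σ ok# 0) ℚ.* β ^ℚ i
      after : ∀ σ′ w → (Accepted w × Frame (σ ok# 0) i σ′) ⊎ (¬ Accepted w × Frame 0 i σ′) →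
              (a? : Dec (Accepted w)) →
              Trying i σ′ (x ℚ.* indicator (does a?)) × σ′ trial# 0 ≡ i
      after σ′ w (inj₁ (acc , inp , l , o , t)) (yes _) = (inp , l ,
        trans (ℚ.*-identityʳ x) (cong (λ o → weight o ℚ.* β ^ℚ i) (sym o))) , t
      after σ′ w (inj₂ (acc , inp , l , o , t)) (no _) = (inp , l ,
        trans (ℚ.*-zeroʳ x) (trans (sym (ℚ.*-zeroˡ (β ^ℚ i))) (cong (λ o → weight o ℚ.* β ^ℚ i) (sym o)))) , t
      after σ′ w (inj₁ (acc , _)) (no ¬acc) = ⊥-elim (¬acc acc)
      after σ′ w (inj₂ (¬acc , _)) (yes acc) = ⊥-elim (¬acc acc)

    sampling-executes : ∀ n σ → Input σ → σ found# 0 ∸ 1 ≡ L →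
      ⟦ div ⟧ᵒ (3 * ε₂) ε₁ + 1 ≡ n →
      Execution sampling σ (samplingTime n) (β ^ℚ n)
    sampling-executes n σ inp l count =
      subst (Execution _ _ _) (ℚ.*-identityˡ (β ^ℚ n)) (
      assigns 0 1 refl refl (
      assigns 0 n refl (trans (cong₂ (λ a b → ⟦ div ⟧ᵒ (3 * a) b + 1) den≡ num≡) count) (
      for-spec {c = trialTime} Trying try n _ _ (inp , l , refl) refl λ { σ′ _ (_ , _ , refl) →
      assigns 0 (σ′ ok# 0) refl refl (
      subst (Execution _ _ _) (sym (ℚ.*-identityʳ (weight (σ′ ok# 0)))) halts) })))
      where open Inputs inp

-- Natural numbers as rationals

toℚᵘ-fraction : ∀ a b .{{_ : NonZero b}} → toℚᵘ (+ a ℚ./ b) ℚᵘ.≃ (+ a ℚᵘ./ b)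
toℚᵘ-fraction a (suc b-1) = ℚ.toℚᵘ-fromℚᵘ (mkℚᵘ (+ a) b-1)

fraction-* : ∀ a b .{{_ : NonZero b}} → (+ a ℚ./ b) ℚ.* fromℕ b ≡ fromℕ a
fraction-* a b@(suc b-1) = ℚ.toℚᵘ-injective (begin
  toℚᵘ ((+ a ℚ./ b) ℚ.* fromℕ b)           ≈⟨ ℚ.toℚᵘ-homo-* (+ a ℚ./ b) (fromℕ b) ⟩
  toℚᵘ (+ a ℚ./ b) ℚᵘ.* toℚᵘ (fromℕ b)     ≈⟨ ℚᵘ.*-cong (toℚᵘ-fraction a b) (toℚᵘ-fraction b 1) ⟩
  mkℚᵘ (+ a) b-1 ℚᵘ.* mkℚᵘ (+ b) 0         ≈⟨ *≡* (trans (ℤ.*-identityʳ (+ a ℤ.* + b)) (cong (λ n → + a ℤ.* + n) (sym (*-identityʳ b)))) ⟩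
  mkℚᵘ (+ a) 0                             ≈⟨ toℚᵘ-fraction a 1 ⟨
  toℚᵘ (fromℕ a)                           ∎)
  where open ℚᵘ.≃-Reasoning

fromℕ-+ : ∀ m n → fromℕ (m + n) ≡ fromℕ m ℚ.+ fromℕ n
fromℕ-+ m n = ℚ.toℚᵘ-injective (begin
  toℚᵘ (fromℕ (m + n))                    ≈⟨ toℚᵘ-fraction (m + n) 1 ⟩
  mkℚᵘ (+ (m + n)) 0                      ≈⟨ *≡* (cong (ℤ._* + 1) (sym (cong₂ ℤ._+_ (ℤ.*-identityʳ (+ m)) (ℤ.*-identityʳ (+ n))))) ⟩
  mkℚᵘ (+ m) 0 ℚᵘ.+ mkℚᵘ (+ n) 0          ≈⟨ ℚᵘ.+-cong (toℚᵘ-fraction m 1) (toℚᵘ-fraction n 1) ⟨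
  toℚᵘ (fromℕ m) ℚᵘ.+ toℚᵘ (fromℕ n)      ≈⟨ ℚ.toℚᵘ-homo-+ (fromℕ m) (fromℕ n) ⟨
  toℚᵘ (fromℕ m ℚ.+ fromℕ n)              ∎)
  where open ℚᵘ.≃-Reasoning

fromℕ-* : ∀ m n → fromℕ (m * n) ≡ fromℕ m ℚ.* fromℕ n
fromℕ-* m n = ℚ.toℚᵘ-injective (begin
  toℚᵘ (fromℕ (m * n))                    ≈⟨ toℚᵘ-fraction (m * n) 1 ⟩
  mkℚᵘ (+ (m * n)) 0                      ≈⟨ *≡* (cong (ℤ._* + 1) (ℤ.pos-* m n)) ⟩
  mkℚᵘ (+ m) 0 ℚᵘ.* mkℚᵘ (+ n) 0          ≈⟨ ℚᵘ.*-cong (toℚᵘ-fraction m 1) (toℚᵘ-fraction n 1) ⟨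
  toℚᵘ (fromℕ m) ℚᵘ.* toℚᵘ (fromℕ n)      ≈⟨ ℚ.toℚᵘ-homo-* (fromℕ m) (fromℕ n) ⟨
  toℚᵘ (fromℕ m ℚ.* fromℕ n)              ∎)
  where open ℚᵘ.≃-Reasoning

fromℕ-nonNeg : ∀ n → ℚ.NonNegative (fromℕ n)
fromℕ-nonNeg n = ℚ.normalize-nonNeg n 1

fromℕ-pos : ∀ n .{{_ : NonZero n}} → ℚ.Positive (fromℕ n)
fromℕ-pos n = ℚ.normalize-pos n 1

fromℕ-mono-≤ : ∀ {m n} → m ≤ n → fromℕ m ℚ.≤ fromℕ n
fromℕ-mono-≤ {m} {n} m≤n = ℚ.toℚᵘ-cancel-≤ (begin
  toℚᵘ (fromℕ m)  ≃⟨ toℚᵘ-fraction m 1 ⟩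
  mkℚᵘ (+ m) 0    ≤⟨ *≤* (ℤ.*-monoʳ-≤-nonNeg (+ 1) (+≤+ m≤n)) ⟩
  mkℚᵘ (+ n) 0    ≃⟨ toℚᵘ-fraction n 1 ⟨
  toℚᵘ (fromℕ n)  ∎)
  where open ℚᵘ.≤-Reasoning

-- Average acceptance and the density of the language

module _ {s : ℕ} .{{_ : NonZero s}} where

  1/s : ℚ
  1/s = + 1 ℚ./ s

  -- The expected value of f for a uniform word of length j, drawn from its first
  -- letter to its last, in the order in which the list of all words is built.
  mean : ℕ → (Word s → ℚ) → ℚ
  mean zero    f = f []
  mean (suc j) f = 1/s ℚ.* sum (λ c → mean j (λ u → f (c ∷ u)))

  mean-cong : ∀ j {f g} → (∀ w → f w ≡ g w) → mean j f ≡ mean j g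
  mean-cong zero    f≗g = f≗g []
  mean-cong (suc j) f≗g = cong (1/s ℚ.*_) (sum-cong-≗ λ c → mean-cong j λ u → f≗g (c ∷ u))

  mean-0 : ∀ j → mean j (λ _ → 0ℚ) ≡ 0ℚ
  mean-0 zero    = refl
  mean-0 (suc j) = trans (cong (1/s ℚ.*_) (trans (sum-cong-≗ {s} λ _ → mean-0 j)
    (trans (sym (*-distribˡ-sum {s} 0ℚ λ _ → 0ℚ)) (ℚ.*-zeroˡ (sum {s} λ _ → 0ℚ))))) (ℚ.*-zeroʳ 1/s)

  -- The letters may also be drawn starting with the last one.
  mean-snoc : ∀ j f → mean (suc j) f ≡ 1/s ℚ.* sum (λ c → mean j (λ u → f (u ++ c ∷ [])))
  mean-snoc zero    f = refl
  mean-snoc (suc j) f = cong (1/s ℚ.*_) (begin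
    sum (λ c → mean (suc j) (λ u → f (c ∷ u)))        ≡⟨ sum-cong-≗ (λ c → mean-snoc j (λ u → f (c ∷ u))) ⟩
    sum (λ c → 1/s ℚ.* sum (λ d → F c d))             ≡⟨ *-distribˡ-sum 1/s (λ c → sum (F c)) ⟨
    1/s ℚ.* sum (λ c → sum (λ d → F c d))             ≡⟨ cong (1/s ℚ.*_) (∑-comm F) ⟩
    1/s ℚ.* sum (λ d → sum (λ c → F c d))             ≡⟨ *-distribˡ-sum 1/s (λ d → sum (λ c → F c d)) ⟩
    sum (λ d → mean (suc j) (λ u → f (u ++ d ∷ [])))  ∎)
    where
    open ≡-Reasoning
    F : Fin s → Fin s → ℚ
    F c d = mean j (λ u → f (c ∷ u ++ d ∷ []))

  average≡mean : ∀ j f w → average j f w ≡ mean j (λ u → f (u ++ w))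
  average≡mean zero    f w = refl
  average≡mean (suc j) f w = begin
    1/s ℚ.* sum (λ c → average j f (c ∷ w))                     ≡⟨ cong (1/s ℚ.*_) (sum-cong-≗ λ c → trans (average≡mean j f (c ∷ w)) (mean-cong j λ u → cong f (sym (++-assoc u (c ∷ []) w)))) ⟩
    1/s ℚ.* sum (λ c → mean j (λ u → f ((u ++ c ∷ []) ++ w)))   ≡⟨ mean-snoc j (λ u → f (u ++ w)) ⟨
    mean (suc j) (λ u → f (u ++ w))                             ∎
    where open ≡-Reasoning

  count : ∀ {A : Set} {P : A → Set} → Decidable P → List A → ℕ
  count P? xs = length (filter P? xs)

  count-map : ∀ {A B : Set} {P : B → Set} (P? : Decidable P) (f : A → B) xs →
              count P? (map f xs) ≡ count (P? ∘ f) xs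
  count-map P? f []       = refl
  count-map P? f (x ∷ xs) with does (P? (f x))
  ... | true  = cong suc (count-map P? f xs)
  ... | false = count-map P? f xs

  count-words : ∀ {n} {P : Word s → Set} (P? : Decidable P) (h : Fin n → Fin s) ws →
    fromℕ (count P? (cartesianProductWith _∷_ (tabulate h) ws)) ≡
    sum (λ i → fromℕ (count (P? ∘ (h i ∷_)) ws))
  count-words {zero}  P? h ws = refl
  count-words {suc n} P? h ws = begin
    fromℕ (count P? (xs ++ ys))           ≡⟨ cong (fromℕ ∘ length) (filter-++ P? xs ys) ⟩
    fromℕ (length (filter P? xs ++ filter P? ys))   ≡⟨ cong fromℕ (length-++ (filter P? xs)) ⟩
    fromℕ (count P? xs + count P? ys)     ≡⟨ fromℕ-+ (count P? xs) (count P? ys) ⟩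
    fromℕ (count P? xs) ℚ.+ fromℕ (count P? ys)     ≡⟨ cong₂ ℚ._+_ (cong fromℕ (count-map P? (h zero ∷_) ws)) (count-words P? (h ∘ suc) ws) ⟩
    _ ∎
    where
    open ≡-Reasoning
    xs = map (h zero ∷_) ws
    ys = cartesianProductWith _∷_ (tabulate (h ∘ suc)) ws

  count≡mean : ∀ j {P : Word s → Set} (P? : Decidable P) →
    fromℕ (count P? (words s j)) ≡ mean j (indicator ∘ does ∘ P?) ℚ.* fromℕ (s ^ j)
  count≡mean zero P? with does (P? [])
  ... | true  = refl
  ... | false = refl
  count≡mean (suc j) P? = begin
    fromℕ (count P? (words s (suc j)))              ≡⟨ count-words P? (λ c → c) (words s j) ⟩
    sum (λ c → fromℕ (count (P? ∘ (c ∷_)) (words s j))) ≡⟨ sum-cong-≗ (λ c → trans (count≡mean j (P? ∘ (c ∷_))) (ℚ.*-comm (M c) q)) ⟩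
    sum (λ c → q ℚ.* M c)                           ≡⟨ *-distribˡ-sum q M ⟨
    q ℚ.* sum M                                     ≡⟨ cong (ℚ._* sum M) (ℚ.*-identityˡ q) ⟨
    (1ℚ ℚ.* q) ℚ.* sum M                            ≡⟨ cong (λ x → (x ℚ.* q) ℚ.* sum M) (fraction-* 1 s) ⟨
    (1/s ℚ.* fromℕ s ℚ.* q) ℚ.* sum M               ≡⟨ rearrange 1/s (fromℕ s) q (sum M) ⟩
    1/s ℚ.* sum M ℚ.* (fromℕ s ℚ.* q)               ≡⟨ cong (1/s ℚ.* sum M ℚ.*_) (fromℕ-* s (s ^ j)) ⟨
    1/s ℚ.* sum M ℚ.* fromℕ (s ^ suc j)             ∎
    where
    open ≡-Reasoning
    q = fromℕ (s ^ j)
    M : Fin s → ℚ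
    M c = mean j (λ u → indicator (does (P? (c ∷ u))))
    rearrange : ∀ a b c d → (a ℚ.* b ℚ.* c) ℚ.* d ≡ a ℚ.* d ℚ.* (b ℚ.* c)
    rearrange = solve 4 (λ a b c d → (a :* b :* c) :* d := a :* d :* (b :* c)) refl

  B≡mean : (a : BlockNFA s) → B a ≡ mean (BlockNFA.ℓ a) (indicator ∘ does ∘ BlockNFA.accepts? a)
  B≡mean a = ℚ.≤-antisym (cancel (ℚ.≤-reflexive eqn)) (cancel (ℚ.≤-reflexive (sym eqn)))
    where
    open BlockNFA a
    instance
      _ = m^n≢0 s ℓ
      _ = fromℕ-pos (s ^ ℓ)
    eqn : B a ℚ.* fromℕ (s ^ ℓ) ≡ mean ℓ (indicator ∘ does ∘ accepts?) ℚ.* fromℕ (s ^ ℓ)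
    eqn = trans (fraction-* (count accepts? (words s ℓ)) (s ^ ℓ)) (count≡mean ℓ accepts?)
    cancel : ∀ {p q} → p ℚ.* fromℕ (s ^ ℓ) ℚ.≤ q ℚ.* fromℕ (s ^ ℓ) → p ℚ.≤ q
    cancel = ℚ.*-cancelʳ-≤-pos (fromℕ (s ^ ℓ))

-- Error probability and number of trials

^ℚ-nonNeg : ∀ x n .{{_ : ℚ.NonNegative x}} → ℚ.NonNegative (x ^ℚ n)
^ℚ-nonNeg x zero    = _
^ℚ-nonNeg x (suc n) = ℚ.nonNeg*nonNeg⇒nonNeg x (x ^ℚ n) {{^ℚ-nonNeg x n}}

1^ℚ : ∀ n → 1ℚ ^ℚ n ≡ 1ℚ
1^ℚ zero    = refl
1^ℚ (suc n) = trans (ℚ.*-identityˡ (1ℚ ^ℚ n)) (1^ℚ n)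

-- The induction step uses (1 + (n + 1) ε) (1 - ε) ≤ 1 + n ε.
bernoulli : ∀ x ε n .{{_ : ℚ.NonNegative x}} .{{_ : ℚ.NonNegative ε}} → x ℚ.≤ 1ℚ ℚ.- ε →
            x ^ℚ n ℚ.* (1ℚ ℚ.+ fromℕ n ℚ.* ε) ℚ.≤ 1ℚ
bernoulli x ε zero    x≤ = ℚ.≤-reflexive (trans (ℚ.*-identityˡ _) (trans (cong (1ℚ ℚ.+_) (ℚ.*-zeroˡ ε)) refl))
bernoulli x ε (suc n) x≤ = begin
  (x ℚ.* y) ℚ.* (1ℚ ℚ.+ fromℕ (suc n) ℚ.* ε)              ≡⟨ cong (λ z → (x ℚ.* y) ℚ.* (1ℚ ℚ.+ z ℚ.* ε)) (fromℕ-+ 1 n) ⟩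
  (x ℚ.* y) ℚ.* (1ℚ ℚ.+ (1ℚ ℚ.+ k) ℚ.* ε)                 ≡⟨ swap x y (1ℚ ℚ.+ (1ℚ ℚ.+ k) ℚ.* ε) ⟩
  y ℚ.* ((1ℚ ℚ.+ (1ℚ ℚ.+ k) ℚ.* ε) ℚ.* x)                 ≤⟨ ℚ.*-monoˡ-≤-nonNeg y (ℚ.*-monoˡ-≤-nonNeg (1ℚ ℚ.+ (1ℚ ℚ.+ k) ℚ.* ε) x≤) ⟩
  y ℚ.* ((1ℚ ℚ.+ (1ℚ ℚ.+ k) ℚ.* ε) ℚ.* (1ℚ ℚ.- ε))        ≡⟨ cong (y ℚ.*_) (expand k ε) ⟩
  y ℚ.* (1ℚ ℚ.+ k ℚ.* ε ℚ.- (1ℚ ℚ.+ k) ℚ.* (ε ℚ.* ε))     ≤⟨ ℚ.*-monoˡ-≤-nonNeg y drop ⟩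
  y ℚ.* (1ℚ ℚ.+ k ℚ.* ε)                                  ≤⟨ bernoulli x ε n x≤ ⟩
  1ℚ                                                      ∎
  where
  open ℚ.≤-Reasoning
  y = x ^ℚ n
  k = fromℕ n
  instance
    _ = ^ℚ-nonNeg x n
    _ = fromℕ-nonNeg n
    k+1 = ℚ.nonNeg+nonNeg⇒nonNeg 1ℚ k
    _ = ℚ.nonNeg+nonNeg⇒nonNeg 1ℚ ((1ℚ ℚ.+ k) ℚ.* ε) {{ℚ.nonNeg*nonNeg⇒nonNeg (1ℚ ℚ.+ k) ε}}
  swap : ∀ a b c → (a ℚ.* b) ℚ.* c ≡ b ℚ.* (c ℚ.* a)
  swap = solve 3 (λ a b c → (a :* b) :* c := b :* (c :* a)) refl
  expand : ∀ k ε → (1ℚ ℚ.+ (1ℚ ℚ.+ k) ℚ.* ε) ℚ.* (1ℚ ℚ.- ε) ≡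
                   1ℚ ℚ.+ k ℚ.* ε ℚ.- (1ℚ ℚ.+ k) ℚ.* (ε ℚ.* ε)
  expand = solve 2 (λ k ε → (con 1ℚ :+ (con 1ℚ :+ k) :* ε) :* (con 1ℚ :- ε) :=
                     con 1ℚ :+ k :* ε :- (con 1ℚ :+ k) :* (ε :* ε)) refl
  square = (1ℚ ℚ.+ k) ℚ.* (ε ℚ.* ε)
  drop : 1ℚ ℚ.+ k ℚ.* ε ℚ.- square ℚ.≤ 1ℚ ℚ.+ k ℚ.* ε
  drop = subst (1ℚ ℚ.+ k ℚ.* ε ℚ.- square ℚ.≤_) (ℚ.+-identityʳ _)
    (ℚ.+-monoʳ-≤ (1ℚ ℚ.+ k ℚ.* ε) (ℚ.neg-antimono-≤ (ℚ.nonNegative⁻¹ square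
      {{ℚ.nonNeg*nonNeg⇒nonNeg (1ℚ ℚ.+ k) (ε ℚ.* ε) {{ℚ.nonNeg*nonNeg⇒nonNeg ε ε}}}})))

sum-1 : ∀ n → sum {n} (λ _ → 1ℚ) ≡ fromℕ n
sum-1 zero    = refl
sum-1 (suc n) = trans (cong (1ℚ ℚ.+_) (sum-1 n)) (sym (fromℕ-+ 1 n))

Pr-complement : ∀ {s b σ} .{{_ : NonZero s}} (r : Run s b σ) → Pr False r ℚ.+ Pr True r ≡ 1ℚ
Pr-complement (halt {σ}) with True σ
... | true  = refl
... | false = refl
Pr-complement (assign r)     = Pr-complement r
Pr-complement {s} (symbol r) = begin
  1/s ℚ.* sum F ℚ.+ 1/s ℚ.* sum T   ≡⟨ ℚ.*-distribˡ-+ 1/s (sum F) (sum T) ⟨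
  1/s ℚ.* (sum F ℚ.+ sum T)         ≡⟨ cong (1/s ℚ.*_) (∑-distrib-+ F T) ⟨
  1/s ℚ.* sum (λ c → F c ℚ.+ T c)   ≡⟨ cong (1/s ℚ.*_) (trans (sum-cong-≗ λ c → Pr-complement (r c)) (sum-1 s)) ⟩
  1/s ℚ.* fromℕ s                   ≡⟨ fraction-* 1 s ⟩
  1ℚ                                ∎
  where
  open ≡-Reasoning
  F T : Fin s → ℚ
  F c = Pr False (r c)
  T c = Pr True (r c)
Pr-complement (toss {num = num} {den} {σ = σ} h t) =
  trans (regroup (bias (⟦ num ⟧ σ) (⟦ den ⟧ σ)) (Pr False h) (Pr False t) (Pr True h) (Pr True t))
    (trans (cong₂ (λ x y → p ℚ.* x ℚ.+ (1ℚ ℚ.- p) ℚ.* y) (Pr-complement h) (Pr-complement t)) (total p))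
  where
  p = bias (⟦ num ⟧ σ) (⟦ den ⟧ σ)
  regroup : ∀ p a b c d → (p ℚ.* a ℚ.+ (1ℚ ℚ.- p) ℚ.* b) ℚ.+ (p ℚ.* c ℚ.+ (1ℚ ℚ.- p) ℚ.* d) ≡
            p ℚ.* (a ℚ.+ c) ℚ.+ (1ℚ ℚ.- p) ℚ.* (b ℚ.+ d)
  regroup = solve 5 (λ p a b c d → (p :* a :+ (con 1ℚ :- p) :* b) :+ (p :* c :+ (con 1ℚ :- p) :* d) :=
              p :* (a :+ c) :+ (con 1ℚ :- p) :* (b :+ d)) refl
  total : ∀ p → p ℚ.* 1ℚ ℚ.+ (1ℚ ℚ.- p) ℚ.* 1ℚ ≡ 1ℚ
  total = solve 1 (λ p → p :* con 1ℚ :+ (con 1ℚ :- p) :* con 1ℚ := con 1ℚ) refl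
Pr-complement (branch r)     = Pr-complement r
Pr-complement (while r)      = Pr-complement r

numerator-pos : ∀ p → ℚ.Positive p → ∃ λ k → ∣ ↥ p ∣ ≡ suc k
numerator-pos (mkℚ (+ suc k) _ _) _ = k , refl

numerator-fraction : ∀ p → ℚ.Positive p → p ℚ.* fromℕ (↧ₙ p) ≡ fromℕ ∣ ↥ p ∣
numerator-fraction p@(mkℚ (+ suc k) _ _) _ =
  trans (cong (ℚ._* fromℕ (↧ₙ p)) (sym (ℚ.↥p/↧p≡p p))) (fraction-* (suc k) (↧ₙ p))

numerator≤denominator : ∀ p → ℚ.Positive p → p ℚ.< 1ℚ → ∣ ↥ p ∣ ≤ ↧ₙ p
numerator≤denominator p@(mkℚ (+ suc k) d _) _ (*<* p<1) =
  <⇒≤ (ℤ.drop‿+<+ (subst₂ ℤ._<_ (ℤ.*-identityʳ (+ suc k)) (ℤ.*-identityˡ (+ suc d)) p<1))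

-- The number of trials computed by the program, floor (3 / ε) + 1.
trials : Tolerance → ℕ
trials ε = ⟦ div ⟧ᵒ (3 * ↧ₙ value) ∣ ↥ value ∣ + 1
  where open Tolerance ε

div-bounds : ∀ b a → a ≢ 0 → a ≤ b →
             3 * b ≤ (⟦ div ⟧ᵒ (3 * b) a + 1) * a × (⟦ div ⟧ᵒ (3 * b) a + 1) * a ≤ 4 * b
div-bounds b zero      ne _   = ⊥-elim (ne refl)
div-bounds b a@(suc _) _  a≤b =
  (begin
    3 * b                                  ≡⟨ ℕ.m≡m%n+[m/n]*n (3 * b) a ⟩
    (3 * b) ℕ.% a + (3 * b) ℕ./ a * a      ≤⟨ +-monoˡ-≤ _ (<⇒≤ (ℕ.m%n<n (3 * b) a)) ⟩
    a + (3 * b) ℕ./ a * a                  ≡⟨ cong (_* a) (+-comm 1 ((3 * b) ℕ./ a)) ⟩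
    ((3 * b) ℕ./ a + 1) * a                ∎) ,
  (begin
    ((3 * b) ℕ./ a + 1) * a                ≡⟨ cong (_* a) (+-comm ((3 * b) ℕ./ a) 1) ⟩
    a + (3 * b) ℕ./ a * a                  ≤⟨ +-mono-≤ a≤b (ℕ.m/n*n≤m (3 * b) a) ⟩
    4 * b                                  ∎)
  where open ≤-Reasoning

module _ (ε : Tolerance) where
  open Tolerance ε

  private
    instance
      value-pos : ℚ.Positive value
      value-pos = ℚ.positive 0<ε
      value-nonNeg : ℚ.NonNegative value
      value-nonNeg = ℚ.pos⇒nonNeg value
      value-nonZero : ℚ.NonZero value
      value-nonZero = ℚ.pos⇒nonZero value
      inverse-pos : ℚ.Positive inverse
      inverse-pos = ℚ.1/pos⇒pos value
      inverse-nonNeg : ℚ.NonNegative inverse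
      inverse-nonNeg = ℚ.pos⇒nonNeg inverse
      den-pos : ℚ.Positive (fromℕ (↧ₙ value))
      den-pos = fromℕ-pos (↧ₙ value)

    n = trials ε
    num = ∣ ↥ value ∣
    den = ↧ₙ value

    bounds : 3 * den ≤ n * num × n * num ≤ 4 * den
    bounds = div-bounds den num
      (λ e → 0≢1+n (trans (sym e) (proj₂ (numerator-pos value value-pos))))
      (numerator≤denominator value value-pos ε<1)

    scaled : fromℕ n ℚ.* value ℚ.* fromℕ den ≡ fromℕ (n * num)
    scaled = trans (ℚ.*-assoc (fromℕ n) value (fromℕ den))
      (trans (cong (fromℕ n ℚ.*_) (numerator-fraction value value-pos)) (sym (fromℕ-* n num)))

  trials-enough : fromℕ 3 ℚ.≤ fromℕ n ℚ.* value
  trials-enough = ℚ.*-cancelʳ-≤-pos (fromℕ den) (subst₂ ℚ._≤_ (fromℕ-* 3 den) (sym scaled)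
    (fromℕ-mono-≤ (proj₁ bounds)))

  trials-few : fromℕ n ℚ.≤ fromℕ 4 ℚ.* inverse
  trials-few = subst (ℚ._≤ fromℕ 4 ℚ.* inverse)
    (trans (ℚ.*-assoc (fromℕ n) value inverse)
      (trans (cong (fromℕ n ℚ.*_) (ℚ.*-inverseʳ value)) (ℚ.*-identityʳ (fromℕ n))))
    (ℚ.*-monoʳ-≤-nonNeg inverse (ℚ.*-cancelʳ-≤-pos {fromℕ n ℚ.* value} {fromℕ 4} (fromℕ den)
      (subst₂ ℚ._≤_ (sym scaled) (fromℕ-* 4 den) (fromℕ-mono-≤ (proj₂ bounds)))))

  -- As 3 ≤ n ε, the inequality of Bernoulli gives 4 x ^ n ≤ 1.
  rejection : ∀ x .{{_ : ℚ.NonNegative x}} → ¬ (1ℚ ℚ.- value ℚ.≤ x) →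
              + 3 ℚ./ 4 ℚ.≤ 1ℚ ℚ.- x ^ℚ n
  rejection x far = ℚ.+-monoʳ-≤ 1ℚ (ℚ.neg-antimono-≤ quarter)
    where
    y = x ^ℚ n
    instance _ = ^ℚ-nonNeg x n
    quarter : y ℚ.≤ + 1 ℚ./ 4
    quarter = ℚ.*-cancelʳ-≤-pos (fromℕ 4) (ℚ.≤-trans
      (ℚ.*-monoˡ-≤-nonNeg y (ℚ.+-monoʳ-≤ 1ℚ trials-enough))
      (bernoulli x value n (ℚ.<⇒≤ (ℚ.≰⇒> far))))

-- Automata as transition graphs

contents-map : ∀ {A : Set} (f : A → ℕ) xs i → contents (map f xs) (toℕ i) ≡ f (lookup xs i)
contents-map f (x ∷ xs) zero    = refl
contents-map f (x ∷ xs) (suc i) = contents-map f xs i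

flag⇒∈ : ∀ {n} (p : Subset.Subset n) q → contents (flags p) (toℕ q) ≢ 0 → q Subset.∈ p
flag⇒∈ (true ∷ p)  zero    ne = here
flag⇒∈ (false ∷ p) zero    ne = ⊥-elim (ne refl)
flag⇒∈ (_ ∷ p)     (suc q) ne = there (flag⇒∈ p q ne)

∈⇒flag : ∀ {n} (p : Subset.Subset n) q → q Subset.∈ p → contents (flags p) (toℕ q) ≢ 0
∈⇒flag (_ ∷ p) zero    here      = λ ()
∈⇒flag (_ ∷ p) (suc q) (there q∈) = ∈⇒flag p q q∈

module _ {s : ℕ} (a : NFA s) where
  open NFA a

  private
    at : ∀ {t} → t < length transitions → Fin states × Fin s × Fin states
    at t<m = lookup transitions (fromℕ< t<m)

    contents-at : ∀ {f : Fin states × Fin s × Fin states → ℕ} {t} (t<m : t < length transitions) →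
                  contents (map f transitions) t ≡ f (at t<m)
    contents-at {f} t<m =
      trans (cong (contents (map f transitions)) (sym (toℕ-fromℕ< t<m)))
            (contents-map f transitions (fromℕ< t<m))

  graph : Graph s
  graph = record
    { N    = states
    ; m    = length transitions
    ; init = contents (flags initial)
    ; fin  = contents (flags final)
    ; src  = contents (map (λ t → toℕ (proj₁ t)) transitions)
    ; lab  = contents (map (λ t → toℕ (proj₁ (proj₂ t))) transitions)
    ; tgt  = contents (map (λ t → toℕ (proj₂ (proj₂ t))) transitions)
    ; src< = λ t<m → subst (_< states) (sym (contents-at t<m)) (toℕ<n (proj₁ (at t<m)))
    ; tgt< = λ t<m → subst (_< states) (sym (contents-at t<m)) (toℕ<n (proj₂ (proj₂ (at t<m))))
    ; lab∈ = λ t<m → proj₁ (proj₂ (at t<m)) , contents-at t<m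
    }

  open Graph graph

  Acc⇒AcceptsFrom : ∀ w q → Acc w (toℕ q) → AcceptsFrom q w
  Acc⇒AcceptsFrom []      q acc = flag⇒∈ final q acc
  Acc⇒AcceptsFrom (c ∷ w) q (t , t<m , src≡ , lab≡ , acc) =
    q′ , subst (_∈ transitions) (cong₂ (λ x y → x , y , q′)
           (toℕ-injective (trans (sym (contents-at t<m)) src≡))
           (toℕ-injective (trans (sym (contents-at t<m)) lab≡))) (∈-lookup (fromℕ< t<m)) ,
    Acc⇒AcceptsFrom w q′ (subst (Acc w) (contents-at t<m) acc)
    where q′ = proj₂ (proj₂ (at t<m))

  AcceptsFrom⇒Acc : ∀ w q → AcceptsFrom q w → Acc w (toℕ q)
  AcceptsFrom⇒Acc []      q q∈ = ∈⇒flag final q q∈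
  AcceptsFrom⇒Acc (c ∷ w) q (q′ , t∈ , acc) =
    toℕ i , toℕ<n i , field≡ (toℕ ∘ proj₁) , field≡ (toℕ ∘ proj₁ ∘ proj₂) ,
    subst (Acc w) (sym (field≡ (toℕ ∘ proj₂ ∘ proj₂))) (AcceptsFrom⇒Acc w q′ acc)
    where
    i = index t∈
    field≡ : (f : Fin states × Fin s × Fin states → ℕ) →
             contents (map f transitions) (toℕ i) ≡ f (q , c , q′)
    field≡ f = trans (contents-map f transitions i) (cong f (sym (lookup-index t∈)))

  Accepted⇒Accepts : ∀ w → Accepted w → Accepts w
  Accepted⇒Accepts w (q , q<N , iq , acc) =
    fromℕ< q<N , flag⇒∈ initial (fromℕ< q<N) (subst (λ q → init q ≢ 0) (sym (toℕ-fromℕ< q<N)) iq) ,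
    Acc⇒AcceptsFrom w (fromℕ< q<N) (subst (Acc w) (sym (toℕ-fromℕ< q<N)) acc)

  Accepts⇒Accepted : ∀ w → Accepts w → Accepted w
  Accepts⇒Accepted w (q , q∈ , acc) =
    toℕ q , toℕ<n q , ∈⇒flag initial q q∈ , AcceptsFrom⇒Acc w q acc

  accepted? : ∀ w → Dec (Accepted w)
  accepted? w = Dec.map′ (Accepts⇒Accepted w) (Accepted⇒Accepts w) (accepts? w)

-- Running time

module TimeBound {s : ℕ} .{{_ : NonZero s}} (G : Graph s) (ε₁ ε₂ : ℕ) where
  open Graph G
  open SearchExecution G ε₁ ε₂

  -- Since K, M and n are at least 1, constant and linear terms are absorbed by
  -- the product K M n.
  module _ {L K M n : ℕ} (L≤K : L ≤ K) (1≤K : 1 ≤ K) (N≤M : N ≤ M) (m≤M : m ≤ M) (1≤M : 1 ≤ M)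
           (1≤n : 1 ≤ n) where
    open SamplingExecution G ε₁ ε₂ L using (letterTime; trialTime; samplingTime)
    open ≤-Reasoning

    letterTime≤ : letterTime ≤ 61 * M
    letterTime≤ = begin
      letterTime                        ≡⟨ collect N m ⟩
      16 * 1 + (19 * N + 26 * m)        ≤⟨ +-mono-≤ (*-monoʳ-≤ 16 1≤M) (+-mono-≤ (*-monoʳ-≤ 19 N≤M) (*-monoʳ-≤ 26 m≤M)) ⟩
      16 * M + (19 * M + 26 * M)        ≡⟨ total M ⟩
      61 * M                            ∎
      where
      collect : ∀ N m → 2 + (4 + ((N * 19 + 3) + (4 + (m * 26 + 3)))) ≡ 16 * 1 + (19 * N + 26 * m)
      collect = ℕ-Ring.solve-∀
      total : ∀ M → 16 * M + (19 * M + 26 * M) ≡ 61 * M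
      total = ℕ-Ring.solve-∀

    M≤KM : M ≤ K * M
    M≤KM = subst (_≤ K * M) (*-identityˡ M) (*-monoˡ-≤ M 1≤K)

    trialTime≤ : trialTime ≤ 137 * (K * M)
    trialTime≤ = begin
      trialTime                               ≡⟨ collect N L letterTime ⟩
      32 * 1 + (35 * N + L * (9 * 1 + letterTime))
        ≤⟨ +-mono-≤ (*-monoʳ-≤ 32 (≤-trans 1≤M M≤KM)) (+-mono-≤ (*-monoʳ-≤ 35 (≤-trans N≤M M≤KM))
             (*-mono-≤ L≤K (+-mono-≤ (*-monoʳ-≤ 9 1≤M) letterTime≤))) ⟩
      32 * (K * M) + (35 * (K * M) + K * (9 * M + 61 * M)) ≡⟨ total K M ⟩
      137 * (K * M) ∎
      where
      collect : ∀ N L l →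
        4 + ((N * 15 + 3) + (6 + ((L * (9 + l) + 3) + (3 + (4 + ((N * 20 + 3) + 6)))))) ≡
        32 * 1 + (35 * N + L * (9 * 1 + l))
      collect = ℕ-Ring.solve-∀
      total : ∀ K M → 32 * (K * M) + (35 * (K * M) + K * (9 * M + 61 * M)) ≡ 137 * (K * M)
      total = ℕ-Ring.solve-∀

    totalTime≤ : searchTime + samplingTime n ≤ 348 * (K * M) * n
    totalTime≤ = begin
      searchTime + samplingTime n ≡⟨ collect N m n trialTime ⟩
      (38 * 1 + (84 * N + 80 * m)) * 1 + (9 * 1 + trialTime) * n
        ≤⟨ +-mono-≤ (*-mono-≤ (+-mono-≤ (*-monoʳ-≤ 38 (≤-trans 1≤M M≤KM))
               (+-mono-≤ (*-monoʳ-≤ 84 (≤-trans N≤M M≤KM)) (*-monoʳ-≤ 80 (≤-trans m≤M M≤KM)))) 1≤n)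
             (*-monoˡ-≤ n (+-mono-≤ (*-monoʳ-≤ 9 (≤-trans 1≤M M≤KM)) trialTime≤)) ⟩
      (38 * (K * M) + (84 * (K * M) + 80 * (K * M))) * n + (9 * (K * M) + 137 * (K * M)) * n
        ≡⟨ total (K * M) n ⟩
      348 * (K * M) * n ∎
      where
      collect : ∀ N m n t →
        4 + ((m * 24 + 3) + (4 + ((N * 28 + 3) + ((N + m) * 56 + 3)))) + (14 + ((n * (9 + t) + 3) + 4)) ≡
        (38 * 1 + (84 * N + 80 * m)) * 1 + (9 * 1 + t) * n
      collect = ℕ-Ring.solve-∀
      total : ∀ X n → (38 * X + (84 * X + 80 * X)) * n + (9 * X + 137 * X) * n ≡ 348 * X * n
      total = ℕ-Ring.solve-∀

-- Correctness and complexity of the algorithm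

module _ {s : ℕ} .{{_ : NonZero s}} (a : BlockNFA s) where
  open BlockNFA a
  open Graph (graph nfa)

  private
    acceptance : Word s → ℚ
    acceptance w = indicator (does (accepts? w))

  -- A trial with words of the length found by the search succeeds with
  -- probability B a.  If the language is empty, then L need not be ℓ, but both
  -- probabilities are 0.
  mean-length : ∀ {L} → (∃ λ u → Accepted u × length u ≡ L) ⊎ (L ≡ 0 × ∀ w → ¬ Accepted w) →
                L ≤ ℓ × average L acceptance [] ≡ B a
  mean-length {L} outcome = ≤ℓ outcome , (begin
    average L acceptance []              ≡⟨ average≡mean L acceptance [] ⟩
    mean L (λ u → acceptance (u ++ []))  ≡⟨ mean-cong L (λ u → cong acceptance (++-identityʳ u)) ⟩
    mean L acceptance                    ≡⟨ mean≡ outcome ⟩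
    mean ℓ acceptance                    ≡⟨ B≡mean a ⟨
    B a                                  ∎)
    where
    open ≡-Reasoning
    L≡ℓ : ∀ u → Accepted u → length u ≡ L → L ≡ ℓ
    L≡ℓ u acc len = trans (sym len) (wordLength u (Accepted⇒Accepts nfa u acc))
    ≤ℓ : _ → L ≤ ℓ
    ≤ℓ (inj₁ (u , acc , len)) = ≤-reflexive (L≡ℓ u acc len)
    ≤ℓ (inj₂ (refl , _))      = z≤n
    rejected : (∀ w → ¬ Accepted w) → ∀ w → acceptance w ≡ 0ℚ
    rejected none w with accepts? w
    ... | yes acc = ⊥-elim (none w (Accepts⇒Accepted nfa w acc))
    ... | no _    = refl
    mean≡ : _ → mean L acceptance ≡ mean ℓ acceptance
    mean≡ (inj₁ (u , acc , len)) = cong (λ l → mean l acceptance) (L≡ℓ u acc len)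
    mean≡ (inj₂ (_ , none)) = trans (zero-mean L) (sym (zero-mean ℓ))
      where
      zero-mean : ∀ l → mean l acceptance ≡ 0ℚ
      zero-mean l = trans (mean-cong l (rejected none)) (mean-0 l)

  B-nonNeg : ℚ.NonNegative (B a)
  B-nonNeg = ℚ.normalize-nonNeg (count accepts? (words s ℓ)) (s ^ ℓ) {{m^n≢0 s ℓ}}

  module _ (ε : Tolerance) where
    open Tolerance ε
    open Logic s
    open SearchExecution (graph nfa) ∣ ↥ value ∣ (↧ₙ value)

    -- The length L is only known at run time.  Being at most ℓ and at most the
    -- size, it is replaced by the minimum of these.
    timeBound : ℕ
    timeBound = 348 * ((1 ⊔ (ℓ ⊓ size)) * (1 ⊔ size)) * trials ε

    -- Abstract, because comparing types that mention the run must not unfold the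
    -- whole execution tree.
    abstract
      executes : Execution program (encode nfa ε) timeBound (B a ^ℚ trials ε)
      executes = weaken total (search-executes (encode nfa ε) input (λ _ → refl) (λ _ → refl) refl refl
        λ { σ (inp , L≤size , found) →
          let L≤ℓ , β≡ = mean-length found in
          weaken (sampling≤ (⊓-glb L≤ℓ L≤size)) (subst (λ x → Execution sampling σ (sampleTime (σ found# 0 ∸ 1)) (x ^ℚ trials ε)) β≡
            (SamplingExecution.sampling-executes (graph nfa) ∣ ↥ value ∣ (↧ₙ value) (σ found# 0 ∸ 1)
              (accepted? nfa) (trials ε) σ inp refl refl)) })
        where
        n : ℕ
        n = trials ε
        input : Input (encode nfa ε)
        input = record
          { N≡ = refl ; m≡ = refl ; num≡ = refl ; den≡ = refl
          ; init≡ = λ _ → refl ; fin≡ = λ _ → refl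
          ; src≡ = λ _ → refl ; lab≡ = λ _ → refl ; tgt≡ = λ _ → refl }
        sampleTime : ℕ → ℕ
        sampleTime L = SamplingExecution.samplingTime (graph nfa) ∣ ↥ value ∣ (↧ₙ value) L n
        sum≤ : ∀ {L} → L ≤ ℓ ⊓ size → searchTime + sampleTime L ≤ timeBound
        sum≤ {L} L≤ = TimeBound.totalTime≤ (graph nfa) ∣ ↥ value ∣ (↧ₙ value)
          {L} {1 ⊔ (ℓ ⊓ size)} {1 ⊔ size} {n}
          (≤-trans L≤ (m≤n⊔m 1 (ℓ ⊓ size))) (m≤m⊔n 1 (ℓ ⊓ size))
          (≤-trans (m≤m+n states (length transitions)) (m≤n⊔m 1 size))
          (≤-trans (m≤n+m (length transitions) states) (m≤n⊔m 1 size))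
          (m≤m⊔n 1 size) (m≤n+m 1 _)
        rest : ℕ
        rest = timeBound ∸ searchTime
        sampling≤ : ∀ {L} → L ≤ ℓ ⊓ size → sampleTime L ≤ rest
        sampling≤ {L} L≤ = m+n≤o⇒m≤o∸n (sampleTime L)
          (subst (_≤ timeBound) (+-comm searchTime (sampleTime L)) (sum≤ L≤))
        total : searchTime + rest ≤ timeBound
        total = ≤-reflexive (m+[n∸m]≡n (≤-trans (m≤m+n searchTime (sampleTime 0)) (sum≤ z≤n)))

    open Execution executes public using (run)

    time≤ : ∀ {K M} → 1 ⊔ (ℓ ⊓ size) ≤ K → 1 ⊔ size ≤ M →
            fromℕ (time run) ℚ.≤ fromℕ (1392 * (K * M)) ℚ.* inverse
    time≤ {K} {M} k≤ m≤ = begin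
      fromℕ (time run)                                        ≤⟨ fromℕ-mono-≤ (Execution.time≤ executes) ⟩
      fromℕ timeBound                                         ≤⟨ fromℕ-mono-≤ (*-monoˡ-≤ n (*-monoʳ-≤ 348 (*-mono-≤ k≤ m≤))) ⟩
      fromℕ (348 * (K * M) * n)                               ≡⟨ fromℕ-* (348 * (K * M)) n ⟩
      fromℕ (348 * (K * M)) ℚ.* fromℕ n                       ≤⟨ ℚ.*-monoˡ-≤-nonNeg (fromℕ (348 * (K * M))) (trials-few ε) ⟩
      fromℕ (348 * (K * M)) ℚ.* (fromℕ 4 ℚ.* inverse)         ≡⟨ ℚ.*-assoc (fromℕ (348 * (K * M))) (fromℕ 4) inverse ⟨
      fromℕ (348 * (K * M)) ℚ.* fromℕ 4 ℚ.* inverse           ≡⟨ cong (ℚ._* inverse) (fromℕ-* (348 * (K * M)) 4) ⟨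
      fromℕ (348 * (K * M) * 4) ℚ.* inverse                   ≡⟨ cong (λ x → fromℕ x ℚ.* inverse) (constant (K * M)) ⟩
      fromℕ (1392 * (K * M)) ℚ.* inverse                      ∎
      where
      open ℚ.≤-Reasoning
      instance _ = fromℕ-nonNeg (348 * (K * M))
      n = trials ε
      constant : ∀ x → 348 * x * 4 ≡ 1392 * x
      constant = ℕ-Ring.solve-∀

    Pr-True : Pr True run ≡ B a ^ℚ trials ε
    Pr-True = Execution.Pr≡ executes

    Pr-False : Pr False run ≡ 1ℚ ℚ.- B a ^ℚ trials ε
    Pr-False = trans (sym (difference (Pr False run) (Pr True run)))
      (cong₂ ℚ._-_ (Pr-complement run) Pr-True)
      where
      difference : ∀ x y → x ℚ.+ y ℚ.- y ≡ x
      difference = solve 2 (λ x y → x :+ y :- y := x) refl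

-- The polynomial 1392 (1 + x)² y, where 1392 = 4 · 348; the factor 4 comes from
-- n ≤ 4 / ε.
quadratic : List (List ℚ)
quadratic = [] ∷ (c ∷ c ℚ.+ c ∷ c ∷ []) ∷ []
  where c = fromℕ 1392

evalPoly₂-quadratic : ∀ k y → evalPoly₂ quadratic (fromℕ k) y ≡ fromℕ (1392 * (suc k * suc k)) ℚ.* y
evalPoly₂-quadratic k y = trans (expand (fromℕ 1392) (fromℕ k) y) (cong (ℚ._* y) (sym (begin
  fromℕ (1392 * (suc k * suc k))            ≡⟨ fromℕ-* 1392 (suc k * suc k) ⟩
  fromℕ 1392 ℚ.* fromℕ (suc k * suc k)      ≡⟨ cong (fromℕ 1392 ℚ.*_) (fromℕ-* (suc k) (suc k)) ⟩
  fromℕ 1392 ℚ.* (fromℕ (suc k) ℚ.* fromℕ (suc k)) ≡⟨ cong (λ x → fromℕ 1392 ℚ.* (x ℚ.* x)) (fromℕ-+ 1 k) ⟩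
  fromℕ 1392 ℚ.* ((1ℚ ℚ.+ fromℕ k) ℚ.* (1ℚ ℚ.+ fromℕ k)) ∎)))
  where
  open ≡-Reasoning
  expand : ∀ c x y → 0ℚ ℚ.+ y ℚ.* ((c ℚ.+ x ℚ.* (c ℚ.+ c ℚ.+ x ℚ.* (c ℚ.+ x ℚ.* 0ℚ))) ℚ.+ y ℚ.* 0ℚ) ≡
           c ℚ.* ((1ℚ ℚ.+ x) ℚ.* (1ℚ ℚ.+ x)) ℚ.* y
  expand = solve 3 (λ c x y →
    con 0ℚ :+ y :* ((c :+ x :* (c :+ c :+ x :* (c :+ x :* con 0ℚ))) :+ y :* con 0ℚ) :=
    c :* ((con 1ℚ :+ x) :* (con 1ℚ :+ x)) :* y) refl

isPRAX : IsPRAX program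
isPRAX = record
  { run        = run
  ; universal  = λ a ε B≡1 → trans (Pr-True a ε) (trans (cong (_^ℚ trials ε) B≡1) (1^ℚ (trials ε)))
  ; far        = λ a ε far → subst (+ 3 ℚ./ 4 ℚ.≤_) (sym (Pr-False a ε))
                   (rejection ε (B a) {{B-nonNeg a}} far)
  ; polynomial = quadratic , λ a ε → let open BlockNFA a using (ℓ; size) in
      subst (fromℕ (time (run a ε)) ℚ.≤_) (sym (evalPoly₂-quadratic size (Tolerance.inverse ε)))
        (time≤ a ε {suc size} {suc size} (⊔-lub (s≤s z≤n) (≤-trans (m⊓n≤n ℓ size) (n≤1+n size)))
                   (⊔-lub (s≤s z≤n) (n≤1+n size)))
  }

corollary6p1 : ∃ λ (A : Block) → Σ (IsPRAX A) λ P → TimeO[ℓ·size·1/ε] P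
corollary6p1 = program , isPRAX , 1392 , λ a ε → let open BlockNFA a using (ℓ; size) in
  time≤ a ε {1 ⊔ ℓ} {1 ⊔ size} (⊔-monoʳ-≤ 1 (m⊓n≤m ℓ size)) ≤-refl
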